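{- For every composition $\beta$, \[ H_\beta = \sum_T (1-q)^{n(T)}\,\mathcal{Q}'_{\mathrm{shape}(T)}, \] the sum over all immaculate tableaux $T$ of content $\beta$.
   Context: Work over $\mathbb{Q}(q)$. $\mathrm{NSym}$ is the free associative algebra on $H_1,H_2,\dots$ ($H_\beta=H_{\beta_1}\cdots H_{\beta_k}$, $H_0=1$, $H_{ -r}=0$ for $r>0$), graded dual to $\mathrm{QSym}$ via $\langle H_\alpha,M_\beta\rangle=\delta_{\alpha\beta}$ ($M_\beta$ monomial quasisymmetric functions), coproduct $\Delta(H_j)=\sum_iH_i\otimes H_{j-i}$. For $F\in\mathrm{QSym}$, $F^\perp$ satisfies $\langle F^\perp(H),G\rangle=\langle H,FG\rangle$. $F_i=\sum_{\gamma\models i}M_\gamma$ ($F_0=1$), $F_{1^i}=M_{1^i}$. Let $\mathbb{B}_m=\sum_{i\ge0}(-1)^iH_{m+i}F_{1^i}^\perp$, $\widetilde{\mathbb{B}}_m(f)=\sum_{i\ge0}q^i\mathbb{B}_{m+i}(F_i^\perp(f))$, and $\mathcal{Q}'_\alpha=\widetilde{\mathbb{B}}_{\alpha_1}\cdots\widetilde{\mathbb{B}}_{\alpha_m}(1)$. An immaculate tableau of shape $\alpha$ and content $\beta$ (compositions) is a filling of the diagram of $\alpha$ (left-justified rows of lengths $\alpha_i$, row 1 on top) with positive integers, $\beta_i$ of them equal to $i$, rows weakly increasing, first column strictly increasing top to bottom. For such $T$, $n(T)=\sum_{j=1}^{\ell(\alpha)}(d_j(T)-1)$ where $d_j(T)$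 is the number of distinct entries in row $j$. -}

module Defs where

open import Data.Bool using (Bool; true; false; if_then_else_; _∧_)
open import Data.Nat as ℕ using (ℕ; zero; suc; _∸_; _≤ᵇ_; _<ᵇ_; _≡ᵇ_)
open import Data.Integer as ℤ using (ℤ; +_; -_)
open import Data.List using (List; []; _∷_; _++_; map; concatMap; concat; length; foldr; take; drop; replicate; upTo; filter; deduplicate)
open import Data.Nat.ListAction using (sum)
open import Data.List.Properties using (≡-dec)
open import Data.Product using (_×_; _,_; proj₁; proj₂)
open import Relation.Nullary.Decidable using (⌊_⌋)
open import Relation.Binary.PropositionalEquality using (_≡_)

-- Polynomials in q with integer coefficients, as coefficient lists
-- (constant term first).  ℤ[q] ⊂ ℚ(q).

Poly : Set
Poly = List ℤ

addP : Poly → Poly → Poly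
addP [] r = r
addP (a ∷ p) [] = a ∷ p
addP (a ∷ p) (b ∷ r) = (a ℤ.+ b) ∷ addP p r

scalP : ℤ → Poly → Poly
scalP c p = map (c ℤ.*_) p

mulP : Poly → Poly → Poly
mulP [] r = []
mulP (a ∷ p) r = addP (scalP a r) (+ 0 ∷ mulP p r)

constP : ℤ → Poly
constP c = c ∷ []

zeroP : Poly
zeroP = []

oneP : Poly
oneP = constP (+ 1)

powP : Poly → ℕ → Poly
powP p zero = oneP
powP p (suc n) = mulP p (powP p n)

qpow : ℕ → Poly
qpow i = replicate i (+ 0) ++ (+ 1 ∷ [])

oneMinusQ : Poly
oneMinusQ = + 1 ∷ - (+ 1) ∷ []

signP : ℕ → Poly
signP zero = oneP
signP (suc i) = scalP (- (+ 1)) (signP i)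

coefP : Poly → ℕ → ℤ
coefP [] k = + 0
coefP (a ∷ p) zero = a
coefP (a ∷ p) (suc k) = coefP p k

_≈P_ : Poly → Poly → Set
p ≈P r = ∀ k → coefP p k ≡ coefP r k

Comp : Set
Comp = List ℕ

size : List ℕ → ℕ
size = sum

-- All compositions of n, each exactly once: a composition of n+1 is
-- obtained from a unique composition of n either by prepending a part 1
-- or by increasing its first part by 1.
incFirst : Comp → List Comp
incFirst [] = []
incFirst (a ∷ c) = (suc a ∷ c) ∷ []

comps : ℕ → List Comp
comps zero = [] ∷ []
comps (suc n) = concatMap (λ c → (1 ∷ c) ∷ incFirst c) (comps n)

_==_ : List ℕ → List ℕ → Bool
u == v = ⌊ ≡-dec ℕ._≟_ u v ⌋

countIn : List ℕ → List (List ℕ) → ℕ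
countIn u ws = length (filter (λ v → ≡-dec ℕ._≟_ u v) ws)

-- QSym: product of monomial quasisymmetric functions is the
-- quasi-shuffle (stuffle):  M_γ M_δ = Σ_{ε ∈ qsh γ δ} M_ε  (with multiplicity).

qsh : List ℕ → List ℕ → List (List ℕ)
qsh [] b = b ∷ []
qsh (x ∷ a) [] = (x ∷ a) ∷ []
qsh (x ∷ a) (y ∷ b) =
  map (x ∷_) (qsh a (y ∷ b)) ++ map (y ∷_) (qsh (x ∷ a) b) ++ map ((x ℕ.+ y) ∷_) (qsh a b)

-- NSym over ℤ[q]: an element is a finite formal sum Σ c · H_w.
-- Words w are always compositions (H_0 = 1 is implemented by dropping 0).

NSym : Set
NSym = List (Poly × Comp)

H : Comp → NSym
H α = (oneP , α) ∷ []

oneN : NSym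
oneN = H []

_+N_ : NSym → NSym → NSym
f +N g = f ++ g

scaleN : Poly → NSym → NSym
scaleN p f = map (λ t → mulP p (proj₁ t) , proj₂ t) f

sumN : List NSym → NSym
sumN = concat

coeffN : NSym → Comp → Poly
coeffN [] α = zeroP
coeffN ((c , w) ∷ f) α = if w == α then addP c (coeffN f α) else coeffN f α

_≈N_ : NSym → NSym → Set
f ≈N g = ∀ α → coeffN f α ≈P coeffN g α

-- H_0 = 1
consH : ℕ → Comp → Comp
consH zero w = w
consH (suc m) w = suc m ∷ w

Hmul : ℕ → NSym → NSym
Hmul m f = map (λ t → proj₁ t , consH m (proj₂ t)) f

degN : NSym → ℕ
degN f = foldr (λ t d → size (proj₂ t) ℕ.⊔ d) 0 f

-- (M_γ)^⊥ via duality: ⟨M_γ^⊥ H_α , M_δ⟩ = ⟨H_α , M_γ M_δ⟩, so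
-- M_γ^⊥ H_α = Σ_{δ ⊨ |α|-|γ|} (mult. of α in qsh γ δ) H_δ   (0 if |γ| > |α|),
-- extended linearly.
perpM : Comp → NSym → NSym
perpM γ [] = []
perpM γ ((c , w) ∷ f) =
  (if size γ ≤ᵇ size w
   then map (λ δ → mulP c (constP (+ countIn w (qsh γ δ))) , δ) (comps (size w ∸ size γ))
   else [])
  ++ perpM γ f

-- F_i = Σ_{γ ⊨ i} M_γ ,  F_{1^i} = M_{1^i}
perpF : ℕ → NSym → NSym
perpF i f = sumN (map (λ γ → perpM γ f) (comps i))

perpF1 : ℕ → NSym → NSym
perpF1 i f = perpM (replicate i 1) f

-- 𝔹_m f = Σ_{i≥0} (-1)^i H_{m+i} F_{1^i}^⊥(f); terms with i > deg f vanish.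
BB : ℕ → NSym → NSym
BB m f = sumN (map (λ i → scaleN (signP i) (Hmul (m ℕ.+ i) (perpF1 i f))) (upTo (suc (degN f))))

-- 𝔹̃_m f = Σ_{i≥0} q^i 𝔹_{m+i}(F_i^⊥ f); terms with i > deg f vanish.
BBt : ℕ → NSym → NSym
BBt m f = sumN (map (λ i → scaleN (qpow i) (BB (m ℕ.+ i) (perpF i f))) (upTo (suc (degN f))))

Q' : Comp → NSym
Q' α = foldr BBt oneN α

-- Immaculate tableaux.  A filling is a list of rows (row 1 first);
-- its shape is the list of row lengths.

Tableau : Set
Tableau = List (List ℕ)

shape : Tableau → Comp
shape T = map length T

weaklyInc : List ℕ → Bool
weaklyInc [] = true
weaklyInc (x ∷ []) = true
weaklyInc (x ∷ y ∷ r) = (x ≤ᵇ y) ∧ weaklyInc (y ∷ r)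

strictlyInc : List ℕ → Bool
strictlyInc [] = true
strictlyInc (x ∷ []) = true
strictlyInc (x ∷ y ∷ r) = (x <ᵇ y) ∧ strictlyInc (y ∷ r)

firstColumn : Tableau → List ℕ
firstColumn [] = []
firstColumn ([] ∷ T) = firstColumn T
firstColumn ((x ∷ _) ∷ T) = x ∷ firstColumn T

countVal : ℕ → List ℕ → ℕ
countVal i xs = length (filter (λ x → x ℕ.≟ i) xs)

allᵇ : {A : Set} → (A → Bool) → List A → Bool
allᵇ p [] = true
allᵇ p (x ∷ xs) = p x ∧ allᵇ p xs

nonempty : List ℕ → Bool
nonempty [] = false
nonempty (_ ∷ _) = true

isImmaculate : Comp → Tableau → Bool
isImmaculate β T =
  allᵇ nonempty T ∧ allᵇ weaklyInc T ∧ strictlyInc (firstColumn T)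
  ∧ allᵇ (λ x → (1 ≤ᵇ x) ∧ (x ≤ᵇ length β)) (concat T)
  ∧ (map (λ i → countVal (suc i) (concat T)) (upTo (length β)) == β)

cut : Comp → List ℕ → Tableau
cut [] w = []
cut (a ∷ α) w = take a w ∷ cut α (drop a w)

words : ℕ → ℕ → List (List ℕ)
words zero k = [] ∷ []
words (suc n) k = concatMap (λ x → map (x ∷_) (words n k)) (map suc (upTo k))

-- Candidate fillings (each exactly once): any shape α ⊨ |β|, any filling
-- of it with entries in {1,…,ℓ(β)}.  Every immaculate tableau of content
-- β is among them.
candidates : Comp → List Tableau
candidates β = concatMap (λ α → map (cut α) (words (size β) (length β))) (comps (size β))

immaculateTableaux : Comp → List Tableau
immaculateTableaux β = filter (λ T → Data.Bool._≟_ (isImmaculate β T) true) (candidates β)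

distinctCount : List ℕ → ℕ
distinctCount r = length (deduplicate ℕ._≟_ r)

nStat : Tableau → ℕ
nStat T = sum (map (λ r → distinctCount r ∸ 1) T)

IsComposition : List ℕ → Set
IsComposition β = Data.List.Relation.Unary.All.All (λ b → 1 ℕ.≤ b) β
  where import Data.List.Relation.Unary.All

rhs : Comp → NSym
rhs β = sumN (map (λ T → scaleN (powP oneMinusQ (nStat T)) (Q' (shape T))) (immaculateTableaux β))

{-# OPTIONS --safe #-}
module Submission where

-- Let G be the series Σ_k h_k[(1-q)X] = Π_i (1 - q x_i)/(1 - x_i).  Unfolding the definitions,
-- 𝔹̃_m f = Σ_{i,j} (-1)ʲ qⁱ H_{m+i+j} F_{1ʲ}^⊥ F_i^⊥ f, and the series of the F_i scaled by qⁱ, times that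
-- of the (-1)ʲ F_{1ʲ}, is Π_i (1 - x_i)/(1 - q x_i), the inverse of G.  Hence H_m f = Σ_k 𝔹̃_{m+k} (G_k^⊥ f).
-- Since (1 - q x)/(1 - x) = 1 + (1 - q) Σ_{k≥1} xᵏ, skewing H_β by G lowers parts of β at the price of a
-- factor 1 - q per lowered part.  Peeling off the first part of β this way and iterating is the
-- construction of an immaculate tableau row by row: the first row holds all the entries 1, and the
-- amounts by which the other parts are lowered are its numbers of larger entries.

open import Defs
open import Level using (0ℓ)
open import Algebra using (CommutativeRing)
import Algebra.Properties.CommutativeSemigroup as CommutativeSemigroupProperties
import Data.Bool
open import Data.Bool using (Bool; true; false; if_then_else_; _∧_)
open import Data.Bool.Properties using (T-≡)
open import Data.Empty using (⊥-elim)
open import Data.Integer as ℤ using (+_)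
import Data.Integer.Properties as ℤₚ
open import Data.List using (List; []; _∷_; _++_; map; concat; concatMap; applyUpTo; upTo; foldr;
  length; filter; replicate; take; drop; deduplicate)
open import Data.List.Membership.Propositional using (_∈_; find; lose)
open import Data.List.Membership.Propositional.Properties using (∈-concatMap⁺; ∈-concatMap⁻; ∈-map⁺; ∈-map⁻;
  ∈-upTo⁺; ∈-upTo⁻; ∈-filter⁺; ∈-filter⁻)
open import Data.List.Membership.Propositional.Properties.WithK using (unique∧set⇒bag)
open import Data.List.Properties using (≡-dec; filter-accept; filter-reject; filter-all; filter-++; length-++;
  length-replicate; length-take; length-drop; map-id; map-upTo; ++-assoc; ++-cancelˡ; take++drop≡id;
  ∷-injectiveˡ; ∷-injectiveʳ)
open import Data.List.Relation.Binary.BagAndSetEquality using (∼bag⇒↭)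
open import Data.List.Relation.Binary.Permutation.Propositional as Perm using (_↭_; prep; swap)
open import Data.List.Relation.Unary.All as All using (All; []; _∷_)
import Data.List.Relation.Unary.All.Properties as Allₚ
open import Data.List.Relation.Unary.AllPairs using (AllPairs; []; _∷_)
open import Data.List.Relation.Unary.Any using (here; there)
open import Data.List.Relation.Unary.Linked using (Linked; []; [-]; _∷_)
import Data.List.Relation.Unary.Linked.Properties as Linkedₚ
open import Data.List.Relation.Unary.Unique.Propositional using (Unique)
import Data.List.Relation.Unary.Unique.Propositional.Properties as Uniqueₚ
open import Data.Nat as ℕ using (ℕ; zero; suc; _∸_; _≤_; _<_; _≤ᵇ_; _<ᵇ_; z≤n; s≤s)
open import Data.Nat.ListAction using (sum)
import Data.Nat.Properties as ℕₚ
open import Data.Product using (_×_; _,_; proj₁; proj₂; ∃)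
open import Data.Vec as Vec using (Vec; []; _∷_; toList; fromList; zipWith)
import Data.Vec.Properties as Vecₚ
open import Function using (_∘_)
open import Function.Bundles using (mk⇔; Equivalence)
open import Relation.Binary using (Tri; tri<; tri≈; tri>)
open import Relation.Binary.PropositionalEquality as ≡ using (_≡_; _≢_)
import Relation.Binary.Reasoning.Setoid as SetoidReasoning
open import Relation.Nullary using (yes; no; ¬_; Dec)
open import Relation.Nullary.Decidable using (¬?; dec-true; dec-false)

-- Elements of NSym are unreduced formal sums, so the operators are studied through their
-- transposes, which act on functionals `φ` on words. Peeling off the first row of a tableau
-- replaces `φ` by its transpose under the operator of that row, hence the final induction must run
-- over all `φ` at once. The index of the `H` put in front depends on the total degree removed from
-- the rest, a quantity that a functional of the remaining word cannot see; this is why functionals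
-- under a skewing carry the degree as an extra argument. A second obstacle is that a part lowered
-- to 0 disappears from a word, because H_0 = 1, while in a tableau its letter keeps its place in
-- the alphabet. Contents are therefore vectors in which zeros stay, and `strip` translates them
-- into words. The two pictures agree because every series used has constant term 1, so a zero part
-- contributes a factor 1.

variable
  A B : Set

-- Finite sums and the Cauchy product

module FiniteSums (R : CommutativeRing 0ℓ 0ℓ) where
  open CommutativeRing R renaming (Carrier to K)
  open SetoidReasoning setoid
  open CommutativeSemigroupProperties +-commutativeSemigroup using (interchange; x∙yz≈y∙xz)

  ∑∈ : List A → (A → K) → K
  ∑∈ []       f = 0#
  ∑∈ (x ∷ xs) f = f x + ∑∈ xs f

  -- The bound is included: this fits the range `upTo (suc n)` of the operators and the index range
  -- of a Cauchy product.
  ∑≤ : ℕ → (ℕ → K) → K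
  ∑≤ zero    f = f 0
  ∑≤ (suc n) f = f 0 + ∑≤ n (f ∘ suc)

  ∑∈-cong-All : ∀ {f g : A → K} {xs} → All (λ x → f x ≈ g x) xs → ∑∈ xs f ≈ ∑∈ xs g
  ∑∈-cong-All []       = refl
  ∑∈-cong-All (e ∷ es) = +-cong e (∑∈-cong-All es)

  ∑∈-cong : ∀ {f g : A → K} xs → (∀ x → f x ≈ g x) → ∑∈ xs f ≈ ∑∈ xs g
  ∑∈-cong xs e = ∑∈-cong-All (All.universal e xs)

  ∑∈-zero : ∀ (xs : List A) → ∑∈ xs (λ _ → 0#) ≈ 0#
  ∑∈-zero []       = refl
  ∑∈-zero (x ∷ xs) = trans (+-identityˡ _) (∑∈-zero xs)

  ∑∈-++ : ∀ (f : A → K) xs ys → ∑∈ (xs ++ ys) f ≈ ∑∈ xs f + ∑∈ ys f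
  ∑∈-++ f []       ys = sym (+-identityˡ _)
  ∑∈-++ f (x ∷ xs) ys = trans (+-congˡ (∑∈-++ f xs ys)) (sym (+-assoc _ _ _))

  ∑∈-map : ∀ (f : A → K) (g : B → A) xs → ∑∈ (map g xs) f ≈ ∑∈ xs (f ∘ g)
  ∑∈-map f g []       = refl
  ∑∈-map f g (x ∷ xs) = +-congˡ (∑∈-map f g xs)

  ∑∈-concat : ∀ (f : A → K) xss → ∑∈ (concat xss) f ≈ ∑∈ xss (λ xs → ∑∈ xs f)
  ∑∈-concat f []         = refl
  ∑∈-concat f (xs ∷ xss) = trans (∑∈-++ f xs (concat xss)) (+-congˡ (∑∈-concat f xss))

  ∑∈-concatMap : ∀ (f : A → K) (g : B → List A) xs →
                 ∑∈ (concatMap g xs) f ≈ ∑∈ xs (λ x → ∑∈ (g x) f)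
  ∑∈-concatMap f g xs = trans (∑∈-concat f (map g xs)) (∑∈-map (λ ys → ∑∈ ys f) g xs)

  ∑∈-+ : ∀ (f g : A → K) xs → ∑∈ xs (λ x → f x + g x) ≈ ∑∈ xs f + ∑∈ xs g
  ∑∈-+ f g []       = sym (+-identityˡ _)
  ∑∈-+ f g (x ∷ xs) = trans (+-congˡ (∑∈-+ f g xs)) (interchange _ _ _ _)

  ∑∈-distribˡ : ∀ c (f : A → K) xs → c * ∑∈ xs f ≈ ∑∈ xs (λ x → c * f x)
  ∑∈-distribˡ c f []       = zeroʳ c
  ∑∈-distribˡ c f (x ∷ xs) = trans (distribˡ c _ _) (+-congˡ (∑∈-distribˡ c f xs))

  ∑∈-comm : ∀ (f : A → B → K) xs ys →
            ∑∈ xs (λ x → ∑∈ ys (f x)) ≈ ∑∈ ys (λ y → ∑∈ xs (λ x → f x y))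
  ∑∈-comm f []       ys = sym (∑∈-zero ys)
  ∑∈-comm f (x ∷ xs) ys =
    trans (+-congˡ (∑∈-comm f xs ys)) (sym (∑∈-+ (f x) (λ y → ∑∈ xs (λ x → f x y)) ys))

  ∑∈-↭ : ∀ (f : A → K) {xs ys} → xs ↭ ys → ∑∈ xs f ≈ ∑∈ ys f
  ∑∈-↭ f Perm.refl    = refl
  ∑∈-↭ f (prep x p)   = +-congˡ (∑∈-↭ f p)
  ∑∈-↭ f (swap x y p) = trans (x∙yz≈y∙xz _ _ _) (+-congˡ (+-congˡ (∑∈-↭ f p)))
  ∑∈-↭ f (Perm.trans p r) = trans (∑∈-↭ f p) (∑∈-↭ f r)

  ∑≤-cong-≤ : ∀ {f g} n → (∀ {i} → i ≤ n → f i ≈ g i) → ∑≤ n f ≈ ∑≤ n g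
  ∑≤-cong-≤ zero    e = e z≤n
  ∑≤-cong-≤ (suc n) e = +-cong (e z≤n) (∑≤-cong-≤ n (λ i≤n → e (s≤s i≤n)))

  ∑≤-cong : ∀ {f g} n → (∀ i → f i ≈ g i) → ∑≤ n f ≈ ∑≤ n g
  ∑≤-cong n e = ∑≤-cong-≤ n (λ {i} _ → e i)

  ∑≤-zero : ∀ n → ∑≤ n (λ _ → 0#) ≈ 0#
  ∑≤-zero zero    = refl
  ∑≤-zero (suc n) = trans (+-identityˡ _) (∑≤-zero n)

  ∑≤-+ : ∀ n f g → ∑≤ n (λ i → f i + g i) ≈ ∑≤ n f + ∑≤ n g
  ∑≤-+ zero    f g = refl
  ∑≤-+ (suc n) f g = trans (+-congˡ (∑≤-+ n (f ∘ suc) (g ∘ suc))) (interchange _ _ _ _)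

  ∑≤-distribˡ : ∀ n c f → c * ∑≤ n f ≈ ∑≤ n (λ i → c * f i)
  ∑≤-distribˡ zero    c f = refl
  ∑≤-distribˡ (suc n) c f = trans (distribˡ c _ _) (+-congˡ (∑≤-distribˡ n c (f ∘ suc)))

  ∑≤-distribʳ : ∀ n c f → ∑≤ n f * c ≈ ∑≤ n (λ i → f i * c)
  ∑≤-distribʳ n c f = begin
    ∑≤ n f * c            ≈⟨ *-comm _ _ ⟩
    c * ∑≤ n f            ≈⟨ ∑≤-distribˡ n c f ⟩
    ∑≤ n (λ i → c * f i)  ≈⟨ ∑≤-cong n (λ i → *-comm c (f i)) ⟩
    ∑≤ n (λ i → f i * c)  ∎

  ∑≤-last : ∀ n f → ∑≤ (suc n) f ≈ ∑≤ n f + f (suc n)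
  ∑≤-last zero    f = refl
  ∑≤-last (suc n) f = trans (+-congˡ (∑≤-last n (f ∘ suc))) (sym (+-assoc _ _ _))

  ∑≤-extend : ∀ {m n} f → m ≤ n → (∀ {i} → m < i → f i ≈ 0#) → ∑≤ n f ≈ ∑≤ m f
  ∑≤-extend {n = zero}  f z≤n       e = refl
  ∑≤-extend {n = suc n} f z≤n       e =
    trans (+-congˡ (trans (∑≤-cong n (λ i → e (s≤s z≤n))) (∑≤-zero n))) (+-identityʳ _)
  ∑≤-extend             f (s≤s m≤n) e = +-congˡ (∑≤-extend (f ∘ suc) m≤n (λ m<i → e (s≤s m<i)))

  ∑≤-comm-∑∈ : ∀ n (f : ℕ → A → K) xs →
               ∑≤ n (λ i → ∑∈ xs (f i)) ≈ ∑∈ xs (λ x → ∑≤ n (λ i → f i x))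
  ∑≤-comm-∑∈ zero    f xs = refl
  ∑≤-comm-∑∈ (suc n) f xs =
    trans (+-congˡ (∑≤-comm-∑∈ n (f ∘ suc) xs)) (sym (∑∈-+ (f 0) _ xs))

  ∑≤-comm : ∀ m n (f : ℕ → ℕ → K) →
            ∑≤ m (λ i → ∑≤ n (f i)) ≈ ∑≤ n (λ j → ∑≤ m (λ i → f i j))
  ∑≤-comm zero    n f = refl
  ∑≤-comm (suc m) n f =
    trans (+-congˡ (∑≤-comm m n (f ∘ suc))) (sym (∑≤-+ n (f 0) (λ j → ∑≤ m (λ i → f (suc i) j))))

  ∑∈-applyUpTo : ∀ (f : A → K) (g : ℕ → A) n → ∑∈ (applyUpTo g (suc n)) f ≈ ∑≤ n (f ∘ g)
  ∑∈-applyUpTo f g zero    = +-identityʳ _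
  ∑∈-applyUpTo f g (suc n) = +-congˡ (∑∈-applyUpTo f (g ∘ suc) n)

  ∑∈-upTo : ∀ f n → ∑∈ (upTo (suc n)) f ≈ ∑≤ n f
  ∑∈-upTo f = ∑∈-applyUpTo f (λ i → i)

  -- Both sides run over the triangle j + i ≤ n. The induction removes the row j = 0, which meets
  -- each antidiagonal exactly once.
  ∑≤-antidiagonal : ∀ n (f : ℕ → ℕ → K) →
    ∑≤ n (λ j → ∑≤ (n ∸ j) (f j)) ≈ ∑≤ n (λ s → ∑≤ s (λ j → f j (s ∸ j)))
  ∑≤-antidiagonal zero    f = refl
  ∑≤-antidiagonal (suc n) f = begin
    (f 0 0 + ∑≤ n (f 0 ∘ suc)) + ∑≤ n (λ j → ∑≤ (n ∸ j) (f (suc j)))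
      ≈⟨ +-congˡ (∑≤-antidiagonal n (f ∘ suc)) ⟩
    (f 0 0 + ∑≤ n (f 0 ∘ suc)) + ∑≤ n (λ s → ∑≤ s (λ j → f (suc j) (s ∸ j)))
      ≈⟨ +-assoc _ _ _ ⟩
    f 0 0 + (∑≤ n (f 0 ∘ suc) + ∑≤ n (λ s → ∑≤ s (λ j → f (suc j) (s ∸ j))))
      ≈⟨ +-congˡ (sym (∑≤-+ n (f 0 ∘ suc) (λ s → ∑≤ s (λ j → f (suc j) (s ∸ j))))) ⟩
    f 0 0 + ∑≤ n (λ s → f 0 (suc s) + ∑≤ s (λ j → f (suc j) (s ∸ j))) ∎

  -- The summand takes both indices as arguments, so that `n ∸ (n ∸ j)` never arises.
  ∑≤-reverse : ∀ n (f : ℕ → ℕ → K) → ∑≤ n (λ j → f j (n ∸ j)) ≈ ∑≤ n (λ j → f (n ∸ j) j)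
  ∑≤-reverse zero    f = refl
  ∑≤-reverse (suc n) f = begin
    f 0 (suc n) + ∑≤ n (λ j → f (suc j) (n ∸ j))
      ≈⟨ +-congˡ (∑≤-reverse n (f ∘ suc)) ⟩
    f 0 (suc n) + ∑≤ n (λ j → f (suc (n ∸ j)) j)
      ≈⟨ +-congˡ (∑≤-cong-≤ n (λ {j} j≤n →
           reflexive (≡.cong (λ k → f k j) (≡.sym (ℕₚ.+-∸-assoc 1 j≤n))))) ⟩
    f 0 (suc n) + ∑≤ n (λ j → f (suc n ∸ j) j)
      ≈⟨ +-comm _ _ ⟩
    ∑≤ n (λ j → f (suc n ∸ j) j) + f 0 (suc n)
      ≈⟨ +-congˡ (reflexive (≡.cong (λ k → f k (suc n)) (≡.sym (ℕₚ.n∸n≡0 (suc n))))) ⟩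
    ∑≤ n (λ j → f (suc n ∸ j) j) + f (suc n ∸ suc n) (suc n)
      ≈⟨ ∑≤-last n (λ j → f (suc n ∸ j) j) ⟨
    ∑≤ (suc n) (λ j → f (suc n ∸ j) j) ∎

  infixl 7 _⊛_
  -- The Cauchy product, used twice: over ℤ for multiplication in ℤ[q], and over ℤ[q] for the
  -- one-variable factors of multiplicative series.
  _⊛_ : (ℕ → K) → (ℕ → K) → ℕ → K
  (a ⊛ b) n = ∑≤ n (λ j → a j * b (n ∸ j))

  ⊛-cong : ∀ {a a′ b b′} → (∀ i → a i ≈ a′ i) → (∀ i → b i ≈ b′ i) → ∀ n → (a ⊛ b) n ≈ (a′ ⊛ b′) n
  ⊛-cong e e′ n = ∑≤-cong n (λ j → *-cong (e j) (e′ (n ∸ j)))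

  ⊛-comm : ∀ a b n → (a ⊛ b) n ≈ (b ⊛ a) n
  ⊛-comm a b n =
    trans (∑≤-reverse n (λ i j → a i * b j)) (∑≤-cong n (λ j → *-comm (a (n ∸ j)) (b j)))

  ⊛-distribʳ : ∀ c a b n → ((λ i → a i + b i) ⊛ c) n ≈ (a ⊛ c) n + (b ⊛ c) n
  ⊛-distribʳ c a b n = trans (∑≤-cong n (λ j → distribʳ (c (n ∸ j)) (a j) (b j))) (∑≤-+ n _ _)

  ⊛-assoc : ∀ a b c n → ((a ⊛ b) ⊛ c) n ≈ (a ⊛ (b ⊛ c)) n
  ⊛-assoc a b c n = begin
    ∑≤ n (λ s → (a ⊛ b) s * c (n ∸ s))
      ≈⟨ ∑≤-cong n (λ s → trans (∑≤-distribʳ s _ (λ j → a j * b (s ∸ j)))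
           (∑≤-cong-≤ s (λ {j} j≤s → *-congˡ (reflexive (≡.cong (λ k → c (n ∸ k))
             (≡.sym (ℕₚ.m+[n∸m]≡n j≤s))))))) ⟩
    ∑≤ n (λ s → ∑≤ s (λ j → (a j * b (s ∸ j)) * c (n ∸ (j ℕ.+ (s ∸ j)))))
      ≈⟨ ∑≤-antidiagonal n (λ j i → (a j * b i) * c (n ∸ (j ℕ.+ i))) ⟨
    ∑≤ n (λ j → ∑≤ (n ∸ j) (λ i → (a j * b i) * c (n ∸ (j ℕ.+ i))))
      ≈⟨ ∑≤-cong n (λ j → trans
           (∑≤-cong (n ∸ j) (λ i → trans (*-assoc (a j) (b i) _)
             (*-congˡ (*-congˡ (reflexive (≡.cong c (≡.sym (ℕₚ.∸-+-assoc n j i))))))))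
           (sym (∑≤-distribˡ (n ∸ j) (a j) (λ i → b i * c (n ∸ j ∸ i))))) ⟩
    ∑≤ n (λ j → a j * (b ⊛ c) (n ∸ j)) ∎

-- The ring ℤ[q]

module ℤ-Sums = FiniteSums ℤₚ.+-*-commutativeRing

coefP-addP : ∀ p r k → coefP (addP p r) k ≡ coefP p k ℤ.+ coefP r k
coefP-addP []      r       k       = ≡.sym (ℤₚ.+-identityˡ _)
coefP-addP (a ∷ p) []      k       = ≡.sym (ℤₚ.+-identityʳ _)
coefP-addP (a ∷ p) (b ∷ r) zero    = ≡.refl
coefP-addP (a ∷ p) (b ∷ r) (suc k) = coefP-addP p r k

coefP-scalP : ∀ c p k → coefP (scalP c p) k ≡ c ℤ.* coefP p k
coefP-scalP c []      k       = ≡.sym (ℤₚ.*-zeroʳ c)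
coefP-scalP c (a ∷ p) zero    = ≡.refl
coefP-scalP c (a ∷ p) (suc k) = coefP-scalP c p k

-- Coefficient lists obey the ring laws only up to trailing zeros. Passing to coefficient functions
-- reduces the multiplicative laws to those of `_⊛_`.
coefP-mulP : ∀ p r k → coefP (mulP p r) k ≡ (coefP p ℤ-Sums.⊛ coefP r) k
coefP-mulP []      r k       = ≡.sym (≡.trans
  (ℤ-Sums.∑≤-cong k (λ j → ℤₚ.*-zeroˡ (coefP r (k ∸ j)))) (ℤ-Sums.∑≤-zero k))
coefP-mulP (a ∷ p) r zero    =
  ≡.trans (coefP-addP (scalP a r) _ zero) (≡.trans (ℤₚ.+-identityʳ _) (coefP-scalP a r zero))
coefP-mulP (a ∷ p) r (suc k) =
  ≡.trans (coefP-addP (scalP a r) _ (suc k))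
          (≡.cong₂ ℤ._+_ (coefP-scalP a r (suc k)) (coefP-mulP p r k))

negP : Poly → Poly
negP = scalP (ℤ.- (+ 1))

coefP-negP : ∀ p k → coefP (negP p) k ≡ ℤ.- coefP p k
coefP-negP p k = ≡.trans (coefP-scalP (ℤ.- (+ 1)) p k) (ℤₚ.-1*i≡-i (coefP p k))

module _ where
  open ≡.≡-Reasoning
  open ℤ-Sums using (_⊛_; ⊛-cong; ⊛-comm; ⊛-assoc; ⊛-distribʳ)

  addP-cong : ∀ {p p′ r r′} → p ≈P p′ → r ≈P r′ → addP p r ≈P addP p′ r′
  addP-cong {p} {p′} {r} {r′} e e′ k =
    ≡.trans (coefP-addP p r k) (≡.trans (≡.cong₂ ℤ._+_ (e k) (e′ k)) (≡.sym (coefP-addP p′ r′ k)))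

  mulP-cong : ∀ {p p′ r r′} → p ≈P p′ → r ≈P r′ → mulP p r ≈P mulP p′ r′
  mulP-cong {p} {p′} {r} {r′} e e′ k =
    ≡.trans (coefP-mulP p r k) (≡.trans (⊛-cong e e′ k) (≡.sym (coefP-mulP p′ r′ k)))

  addP-assoc : ∀ p r s → addP (addP p r) s ≈P addP p (addP r s)
  addP-assoc p r s k = begin
    coefP (addP (addP p r) s) k             ≡⟨ coefP-addP (addP p r) s k ⟩
    coefP (addP p r) k ℤ.+ coefP s k        ≡⟨ ≡.cong (ℤ._+ coefP s k) (coefP-addP p r k) ⟩
    coefP p k ℤ.+ coefP r k ℤ.+ coefP s k   ≡⟨ ℤₚ.+-assoc (coefP p k) _ _ ⟩
    coefP p k ℤ.+ (coefP r k ℤ.+ coefP s k) ≡⟨ ≡.cong (ℤ._+_ (coefP p k)) (coefP-addP r s k) ⟨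
    coefP p k ℤ.+ coefP (addP r s) k        ≡⟨ coefP-addP p (addP r s) k ⟨
    coefP (addP p (addP r s)) k             ∎

  addP-comm : ∀ p r → addP p r ≈P addP r p
  addP-comm p r k = ≡.trans (coefP-addP p r k)
    (≡.trans (ℤₚ.+-comm (coefP p k) _) (≡.sym (coefP-addP r p k)))

  addP-identityʳ : ∀ p → addP p zeroP ≈P p
  addP-identityʳ p k = ≡.trans (coefP-addP p [] k) (ℤₚ.+-identityʳ _)

  addP-inverseʳ : ∀ p → addP p (negP p) ≈P zeroP
  addP-inverseʳ p k = ≡.trans (coefP-addP p (negP p) k)
    (≡.trans (≡.cong (ℤ._+_ (coefP p k)) (coefP-negP p k)) (ℤₚ.+-inverseʳ (coefP p k)))

  addP-inverseˡ : ∀ p → addP (negP p) p ≈P zeroP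
  addP-inverseˡ p k = ≡.trans (addP-comm (negP p) p k) (addP-inverseʳ p k)

  mulP-comm : ∀ p r → mulP p r ≈P mulP r p
  mulP-comm p r k = ≡.trans (coefP-mulP p r k)
    (≡.trans (⊛-comm (coefP p) (coefP r) k) (≡.sym (coefP-mulP r p k)))

  mulP-assoc : ∀ p r s → mulP (mulP p r) s ≈P mulP p (mulP r s)
  mulP-assoc p r s k = begin
    coefP (mulP (mulP p r) s) k          ≡⟨ coefP-mulP (mulP p r) s k ⟩
    (coefP (mulP p r) ⊛ coefP s) k       ≡⟨ ⊛-cong {b = coefP s} (coefP-mulP p r) (λ _ → ≡.refl) k ⟩
    ((coefP p ⊛ coefP r) ⊛ coefP s) k    ≡⟨ ⊛-assoc (coefP p) (coefP r) (coefP s) k ⟩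
    (coefP p ⊛ (coefP r ⊛ coefP s)) k    ≡⟨ ⊛-cong {coefP p} (λ _ → ≡.refl) (coefP-mulP r s) k ⟨
    (coefP p ⊛ coefP (mulP r s)) k       ≡⟨ coefP-mulP p (mulP r s) k ⟨
    coefP (mulP p (mulP r s)) k          ∎

  mulP-distribʳ : ∀ s p r → mulP (addP p r) s ≈P addP (mulP p s) (mulP r s)
  mulP-distribʳ s p r k = begin
    coefP (mulP (addP p r) s) k                      ≡⟨ coefP-mulP (addP p r) s k ⟩
    (coefP (addP p r) ⊛ coefP s) k                   ≡⟨ ⊛-cong {b = coefP s} (coefP-addP p r) (λ _ → ≡.refl) k ⟩
    ((λ i → coefP p i ℤ.+ coefP r i) ⊛ coefP s) k    ≡⟨ ⊛-distribʳ (coefP s) (coefP p) (coefP r) k ⟩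
    (coefP p ⊛ coefP s) k ℤ.+ (coefP r ⊛ coefP s) k  ≡⟨ ≡.cong₂ ℤ._+_ (coefP-mulP p s k) (coefP-mulP r s k) ⟨
    coefP (mulP p s) k ℤ.+ coefP (mulP r s) k        ≡⟨ coefP-addP (mulP p s) (mulP r s) k ⟨
    coefP (addP (mulP p s) (mulP r s)) k             ∎

  mulP-distribˡ : ∀ s p r → mulP s (addP p r) ≈P addP (mulP s p) (mulP s r)
  mulP-distribˡ s p r k = begin
    coefP (mulP s (addP p r)) k                ≡⟨ mulP-comm s (addP p r) k ⟩
    coefP (mulP (addP p r) s) k                ≡⟨ mulP-distribʳ s p r k ⟩
    coefP (addP (mulP p s) (mulP r s)) k       ≡⟨ addP-cong {mulP p s} {mulP s p} (mulP-comm p s) (mulP-comm r s) k ⟩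
    coefP (addP (mulP s p) (mulP s r)) k       ∎

  mulP-identityˡ : ∀ p → mulP oneP p ≈P p
  mulP-identityˡ p k = begin
    coefP (addP (scalP (+ 1) p) (+ 0 ∷ [])) k       ≡⟨ coefP-addP (scalP (+ 1) p) (+ 0 ∷ []) k ⟩
    coefP (scalP (+ 1) p) k ℤ.+ coefP (+ 0 ∷ []) k  ≡⟨ ≡.cong₂ ℤ._+_ (coefP-scalP (+ 1) p k) (coefP-0 k) ⟩
    + 1 ℤ.* coefP p k ℤ.+ + 0                       ≡⟨ ℤₚ.+-identityʳ _ ⟩
    + 1 ℤ.* coefP p k                               ≡⟨ ℤₚ.*-identityˡ _ ⟩
    coefP p k                                       ∎
    where
    coefP-0 : ∀ k → coefP (+ 0 ∷ []) k ≡ + 0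
    coefP-0 zero    = ≡.refl
    coefP-0 (suc k) = ≡.refl

  mulP-identityʳ : ∀ p → mulP p oneP ≈P p
  mulP-identityʳ p k = ≡.trans (mulP-comm p oneP k) (mulP-identityˡ p k)

-- A record, unlike the function type p ≈P r, lets unification recover p and r.
record _≋_ (p r : Poly) : Set where
  constructor coefwise
  field coefs : p ≈P r
open _≋_

polyRing : CommutativeRing 0ℓ 0ℓ
polyRing = record
  { Carrier = Poly ; _≈_ = _≋_ ; _+_ = addP ; _*_ = mulP ; -_ = negP ; 0# = zeroP ; 1# = oneP
  ; isCommutativeRing = record
    { isRing = record
      { +-isAbelianGroup = record
        { isGroup = record
          { isMonoid = record
            { isSemigroup = record
              { isMagma = record
                { isEquivalence = record
                  { refl  = coefwise (λ _ → ≡.refl)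
                  ; sym   = λ e → coefwise (λ k → ≡.sym (coefs e k))
                  ; trans = λ e e′ → coefwise (λ k → ≡.trans (coefs e k) (coefs e′ k)) }
                ; ∙-cong = λ {p} {p′} {r} {r′} e e′ →
                    coefwise (addP-cong {p} {p′} {r} {r′} (coefs e) (coefs e′)) }
              ; assoc = λ p r s → coefwise (addP-assoc p r s) }
            ; identity = (λ p → coefwise (λ k → ≡.refl)) , λ p → coefwise (addP-identityʳ p) }
          ; inverse = (λ p → coefwise (addP-inverseˡ p)) , λ p → coefwise (addP-inverseʳ p)
          ; ⁻¹-cong = λ {p} {r} e → coefwise (λ k → ≡.trans (coefP-negP p k)
                        (≡.trans (≡.cong ℤ.-_ (coefs e k)) (≡.sym (coefP-negP r k)))) }
        ; comm = λ p r → coefwise (addP-comm p r) }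
      ; *-cong = λ {p} {p′} {r} {r′} e e′ →
          coefwise (mulP-cong {p} {p′} {r} {r′} (coefs e) (coefs e′))
      ; *-assoc = λ p r s → coefwise (mulP-assoc p r s)
      ; *-identity = (λ p → coefwise (mulP-identityˡ p)) , λ p → coefwise (mulP-identityʳ p)
      ; distrib = (λ s p r → coefwise (mulP-distribˡ s p r)) , λ s p r → coefwise (mulP-distribʳ s p r) }
    ; *-comm = λ p r → coefwise (mulP-comm p r) } }

-- Skewing by multiplicative series

-- Translates a content, where a position names a letter and may hold 0, into the word of an `H`,
-- where H_0 = 1.
strip : Comp → Comp
strip = foldr consH []

module Skewing (R : CommutativeRing 0ℓ 0ℓ) where
  open CommutativeRing R renaming (Carrier to K)
  open FiniteSums R
  open SetoidReasoning setoid
  private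
    module * = CommutativeSemigroupProperties *-commutativeSemigroup

  open import Algebra.Properties.Ring ring using (-‿distribˡ-*)

  -- The adjoint of f ↦ Σ_k A_k^⊥ f, where Σ_k A_k = Π_i Σ_j a_j x_iʲ; Φ also receives the removed degree k,
  -- increased by n.
  skew : (ℕ → K) → (ℕ → Comp → K) → ℕ → Comp → K
  skew a Φ n []      = Φ n []
  skew a Φ n (x ∷ w) = ∑≤ x (λ j → a j * skew a (λ k u → Φ k (consH (x ∸ j) u)) (j ℕ.+ n) w)

  skew-congˡ : ∀ {a b} Φ n w → (∀ i → a i ≈ b i) → skew a Φ n w ≈ skew b Φ n w
  skew-congˡ Φ n []      e = refl
  skew-congˡ Φ n (x ∷ w) e = ∑≤-cong x (λ j → *-cong (e j) (skew-congˡ _ (j ℕ.+ n) w e))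

  skew-congʳ : ∀ a {Φ Ψ} n w → (∀ k u → Φ k u ≈ Ψ k u) → skew a Φ n w ≈ skew a Ψ n w
  skew-congʳ a n []      e = e n []
  skew-congʳ a n (x ∷ w) e =
    ∑≤-cong x (λ j → *-congˡ (skew-congʳ a (j ℕ.+ n) w (λ k u → e k (consH (x ∸ j) u))))

  skew-∑≤ : ∀ a m (b : ℕ → K) (Φ : ℕ → ℕ → Comp → K) n w →
    skew a (λ k u → ∑≤ m (λ i → b i * Φ i k u)) n w ≈ ∑≤ m (λ i → b i * skew a (Φ i) n w)
  skew-∑≤ a m b Φ n []      = refl
  skew-∑≤ a m b Φ n (x ∷ w) = begin
    ∑≤ x (λ j → a j * skew a (λ k u → ∑≤ m (λ i → b i * Φ i k (consH (x ∸ j) u))) (j ℕ.+ n) w)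
      ≈⟨ ∑≤-cong x (λ j → *-congˡ {a j} (skew-∑≤ a m b (λ i k u → Φ i k (consH (x ∸ j) u)) (j ℕ.+ n) w)) ⟩
    ∑≤ x (λ j → a j * ∑≤ m (λ i → b i * S i j))
      ≈⟨ ∑≤-cong x (λ j → ∑≤-distribˡ m (a j) (λ i → b i * S i j)) ⟩
    ∑≤ x (λ j → ∑≤ m (λ i → a j * (b i * S i j)))
      ≈⟨ ∑≤-comm x m (λ j i → a j * (b i * S i j)) ⟩
    ∑≤ m (λ i → ∑≤ x (λ j → a j * (b i * S i j)))
      ≈⟨ ∑≤-cong m (λ i → trans (∑≤-cong x (λ j → *.x∙yz≈y∙xz (a j) (b i) (S i j)))
                                (sym (∑≤-distribˡ x (b i) (λ j → a j * S i j)))) ⟩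
    ∑≤ m (λ i → b i * ∑≤ x (λ j → a j * S i j)) ∎
    where
    S : ℕ → ℕ → K
    S i j = skew a (λ k u → Φ i k (consH (x ∸ j) u)) (j ℕ.+ n) w

  -- The removed degree only accumulates additively. Moving an offset into its starting value lets
  -- 𝔹_{m+i} for all i, and rows of all lengths, share one functional.
  skew-shift : ∀ a Φ i n w → skew a (λ k u → Φ (i ℕ.+ k) u) n w ≈ skew a Φ (i ℕ.+ n) w
  skew-shift a Φ i n []      = refl
  skew-shift a Φ i n (x ∷ w) = ∑≤-cong x (λ j → *-congˡ (trans
    (skew-shift a (λ k u → Φ k (consH (x ∸ j) u)) i (j ℕ.+ n) w)
    (reflexive (≡.cong (λ m → skew a (λ k u → Φ k (consH (x ∸ j) u)) m w) (i+j+n j)))))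
    where
    i+j+n : ∀ j → i ℕ.+ (j ℕ.+ n) ≡ j ℕ.+ (i ℕ.+ n)
    i+j+n j = ≡.trans (≡.sym (ℕₚ.+-assoc i j n))
                (≡.trans (≡.cong (ℕ._+ n) (ℕₚ.+-comm i j)) (ℕₚ.+-assoc j i n))

  -- A zero part can only be lowered by 0, at the price `a 0`, which is 1. The recursion thus holds
  -- even when `consH` has dropped the part.
  skew-consH : ∀ {a} → a 0 ≈ 1# → ∀ Φ n x w → skew a Φ n (consH x w) ≈
    ∑≤ x (λ j → a j * skew a (λ k u → Φ k (consH (x ∸ j) u)) (j ℕ.+ n) w)
  skew-consH a₀ Φ n zero    w = sym (trans (*-congʳ a₀) (*-identityˡ _))
  skew-consH a₀ Φ n (suc x) w = refl

  -- Skewings compose by multiplying the series, and a product of multiplicative series multiplies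
  -- their one-variable factors. A part that loses j to `a` and then i to `b` loses s = j + i in
  -- all, whence the sum over antidiagonals.
  skew-skew : ∀ a b → b 0 ≈ 1# → ∀ Φ n w → skew a (skew b Φ) n w ≈ skew (a ⊛ b) Φ n w
  skew-skew a b b₀ Φ n []      = refl
  skew-skew a b b₀ Φ n (x ∷ w) = begin
    ∑≤ x (λ j → a j * skew a (λ k u → skew b Φ k (consH (x ∸ j) u)) (j ℕ.+ n) w)
      ≈⟨ ∑≤-cong x (λ j → trans (*-congˡ (step j)) (∑≤-distribˡ (x ∸ j) (a j) _)) ⟩
    ∑≤ x (λ j → ∑≤ (x ∸ j) (λ i → a j * (b i * S (x ∸ j ∸ i) (i ℕ.+ (j ℕ.+ n)))))
      ≈⟨ ∑≤-antidiagonal x (λ j i → a j * (b i * S (x ∸ j ∸ i) (i ℕ.+ (j ℕ.+ n)))) ⟩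
    ∑≤ x (λ s → ∑≤ s (λ j → a j * (b (s ∸ j) * S (x ∸ j ∸ (s ∸ j)) (s ∸ j ℕ.+ (j ℕ.+ n)))))
      ≈⟨ ∑≤-cong x (λ s → trans (∑≤-cong-≤ s (λ {j} j≤s →
           trans (sym (*-assoc (a j) (b (s ∸ j)) _))
             (*-congˡ (reflexive (≡.cong₂ S (eq₁ j≤s) (eq₂ j≤s))))))
             (sym (∑≤-distribʳ s (S (x ∸ s) (s ℕ.+ n)) (λ j → a j * b (s ∸ j))))) ⟩
    ∑≤ x (λ s → (a ⊛ b) s * S (x ∸ s) (s ℕ.+ n)) ∎
    where
    Φ⟨_⟩ : ℕ → ℕ → Comp → K
    Φ⟨ y ⟩ k u = Φ k (consH y u)
    S : ℕ → ℕ → K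
    S y m = skew (a ⊛ b) Φ⟨ y ⟩ m w
    step : ∀ j → skew a (λ k u → skew b Φ k (consH (x ∸ j) u)) (j ℕ.+ n) w ≈
                 ∑≤ (x ∸ j) (λ i → b i * S (x ∸ j ∸ i) (i ℕ.+ (j ℕ.+ n)))
    step j = begin
      skew a (λ k u → skew b Φ k (consH (x ∸ j) u)) (j ℕ.+ n) w
        ≈⟨ skew-congʳ a (j ℕ.+ n) w (λ k u → skew-consH b₀ Φ k (x ∸ j) u) ⟩
      skew a (λ k u → ∑≤ (x ∸ j) (λ i → b i * skew b Φ⟨ x ∸ j ∸ i ⟩ (i ℕ.+ k) u)) (j ℕ.+ n) w
        ≈⟨ skew-∑≤ a (x ∸ j) b (λ i k u → skew b Φ⟨ x ∸ j ∸ i ⟩ (i ℕ.+ k) u) (j ℕ.+ n) w ⟩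
      ∑≤ (x ∸ j) (λ i → b i * skew a (λ k u → skew b Φ⟨ x ∸ j ∸ i ⟩ (i ℕ.+ k) u) (j ℕ.+ n) w)
        ≈⟨ ∑≤-cong (x ∸ j) (λ i → *-congˡ {b i} (trans
             (skew-shift a (skew b Φ⟨ x ∸ j ∸ i ⟩) i (j ℕ.+ n) w)
             (skew-skew a b b₀ Φ⟨ x ∸ j ∸ i ⟩ (i ℕ.+ (j ℕ.+ n)) w))) ⟩
      ∑≤ (x ∸ j) (λ i → b i * S (x ∸ j ∸ i) (i ℕ.+ (j ℕ.+ n))) ∎
    eq₁ : ∀ {s j} → j ≤ s → x ∸ j ∸ (s ∸ j) ≡ x ∸ s
    eq₁ {s} {j} j≤s = ≡.trans (ℕₚ.∸-+-assoc x j (s ∸ j)) (≡.cong (x ∸_) (ℕₚ.m+[n∸m]≡n j≤s))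
    eq₂ : ∀ {s j} → j ≤ s → s ∸ j ℕ.+ (j ℕ.+ n) ≡ s ℕ.+ n
    eq₂ {s} {j} j≤s = ≡.trans (≡.sym (ℕₚ.+-assoc (s ∸ j) j n)) (≡.cong (ℕ._+ n) (ℕₚ.m∸n+n≡m j≤s))

  δ : ℕ → K
  δ zero    = 1#
  δ (suc i) = 0#

  -- Skewing by the series 1 removes nothing; `strip` appears because the word is rebuilt with
  -- `consH`.
  skew-δ : ∀ Φ n w → skew δ Φ n w ≈ Φ n (strip w)
  skew-δ Φ n []      = refl
  skew-δ Φ n (x ∷ w) = begin
    ∑≤ x (λ j → δ j * skew δ (λ k u → Φ k (consH (x ∸ j) u)) (j ℕ.+ n) w)
      ≈⟨ ∑≤-extend {n = x} (λ j → δ j * skew δ (λ k u → Φ k (consH (x ∸ j) u)) (j ℕ.+ n) w)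
           z≤n (λ { (s≤s _) → zeroˡ _ }) ⟩
    1# * skew δ (λ k u → Φ k (consH x u)) n w
      ≈⟨ *-identityˡ _ ⟩
    skew δ (λ k u → Φ k (consH x u)) n w
      ≈⟨ skew-δ (λ k u → Φ k (consH x u)) n w ⟩
    Φ n (consH x (strip w)) ∎

  -- The one-variable factors of Σ F_i, Σ (-1)ⁱ F_{1ⁱ}, Σ qⁱ F_i and Σ h_k[(1-q)X].
  ones altE : ℕ → K
  ones i = 1#

  altE 0             = 1#
  altE 1             = - 1#
  altE (suc (suc i)) = 0#

  qPow hook : K → ℕ → K
  qPow q zero    = 1#
  qPow q (suc i) = q * qPow q i

  hook q zero    = 1#
  hook q (suc i) = 1# - q

  -- This is 1/(1 - x) times 1 - x. The two-term factor is moved to the left, where the tail of the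
  -- sum vanishes visibly.
  ones⊛altE : ∀ n → (ones ⊛ altE) n ≈ δ n
  ones⊛altE n = trans (⊛-comm ones altE n) (lemma n)
    where
    lemma : ∀ n → (altE ⊛ ones) n ≈ δ n
    lemma zero    = *-identityˡ 1#
    lemma (suc n) = begin
      1# * 1# + ∑≤ n (λ j → altE (suc j) * 1#)
        ≈⟨ +-cong (*-identityˡ 1#) (∑≤-extend {n = n} _ z≤n (λ { (s≤s _) → zeroˡ _ })) ⟩
      1# + - 1# * 1#
        ≈⟨ +-congˡ (*-identityʳ _) ⟩
      1# - 1#
        ≈⟨ -‿inverseʳ 1# ⟩
      0# ∎

  -- This is (1 - q x)/(1 - x) times 1/(1 - q x). The sum telescopes, since (1 - q) qʲ = qʲ - qʲ⁺¹.
  hook⊛qPow : ∀ q n → (hook q ⊛ qPow q) n ≈ ones n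
  hook⊛qPow q zero    = *-identityˡ 1#
  hook⊛qPow q (suc n) = begin
    1# * (q * qPow q n) + ∑≤ n (λ j → (1# - q) * qPow q (n ∸ j))  ≈⟨ +-cong (*-identityˡ _) (geometric n) ⟩
    q * qPow q n + (1# - q * qPow q n)                            ≈⟨ +-comm _ _ ⟩
    (1# - q * qPow q n) + q * qPow q n                            ≈⟨ cancel 1# (q * qPow q n) ⟩
    1# ∎
    where
    cancel : ∀ x y → (x - y) + y ≈ x
    cancel x y = trans (+-assoc x (- y) y) (trans (+-congˡ (-‿inverseˡ y)) (+-identityʳ x))
    factor : ∀ x → (1# - q) * x ≈ x - q * x
    factor x = trans (distribʳ x 1# (- q)) (+-cong (*-identityˡ x) (sym (-‿distribˡ-* q x)))
    geometric : ∀ n → ∑≤ n (λ j → (1# - q) * qPow q (n ∸ j)) ≈ 1# - q * qPow q n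
    geometric zero    = factor 1#
    geometric (suc n) = begin
      (1# - q) * qPow q (suc n) + ∑≤ n (λ j → (1# - q) * qPow q (n ∸ j))
        ≈⟨ +-cong (factor (qPow q (suc n))) (geometric n) ⟩
      (qPow q (suc n) - q * qPow q (suc n)) + (1# - qPow q (suc n))
        ≈⟨ +-comm _ _ ⟩
      (1# - qPow q (suc n)) + (qPow q (suc n) - q * qPow q (suc n))
        ≈⟨ +-assoc _ _ _ ⟨
      ((1# - qPow q (suc n)) + qPow q (suc n)) - q * qPow q (suc n)
        ≈⟨ +-congʳ (cancel 1# (qPow q (suc n))) ⟩
      1# - q * qPow q (suc n) ∎

  -- The transposed form of the cancellation of G against the series in 𝔹̃: the factors are merged
  -- from the outside in, `hook q` with `qPow q` to `ones`, then `ones` with `altE` to `δ`.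
  skew-inverse : ∀ q Φ n w → skew (hook q) (skew (qPow q) (skew altE Φ)) n w ≈ Φ n (strip w)
  skew-inverse q Φ n w = begin
    skew (hook q) (skew (qPow q) (skew altE Φ)) n w
      ≈⟨ skew-skew (hook q) (qPow q) refl (skew altE Φ) n w ⟩
    skew (hook q ⊛ qPow q) (skew altE Φ) n w
      ≈⟨ skew-congˡ (skew altE Φ) n w (hook⊛qPow q) ⟩
    skew ones (skew altE Φ) n w
      ≈⟨ skew-skew ones altE refl Φ n w ⟩
    skew (ones ⊛ altE) Φ n w
      ≈⟨ skew-congˡ Φ n w ones⊛altE ⟩
    skew δ Φ n w
      ≈⟨ skew-δ Φ n w ⟩
    Φ n (strip w) ∎

-- Compositions and the adjoint of the quasi-shuffle

-- The map `g` recovers from an element the index of its block, which makes the blocks disjoint. The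
-- enumerations of compositions, splits, tableaux, words and candidates are all shown free of
-- repetition in this way.
Unique-concatMap : (f : A → List B) (g : B → A) {xs : List A} → Unique xs →
  (∀ {x} → x ∈ xs → Unique (f x)) → (∀ {x y} → x ∈ xs → y ∈ f x → g y ≡ x) → Unique (concatMap f xs)
Unique-concatMap f g []                    uf retract = []
Unique-concatMap f g {x ∷ xs} (x∉ ∷ uxs) uf retract =
  Uniqueₚ.++⁺ (uf (here ≡.refl)) (Unique-concatMap f g uxs (uf ∘ there) (retract ∘ there)) disjoint
  where
  disjoint : ∀ {y} → ¬ (y ∈ f x × y ∈ concatMap f xs)
  disjoint (y∈ , y∈′) with z , z∈ , y∈fz ← find (∈-concatMap⁻ f {xs = xs} y∈′) =
    All.lookup x∉ z∈ (≡.trans (≡.sym (retract (here ≡.refl) y∈)) (retract (there z∈) y∈fz))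

-- The retraction is asked for on members of `xs` only: `cut α` forgets the letters beyond position
-- |α|, so it is not injective on all words.
Unique-map : (f : A → B) (g : B → A) {xs : List A} → Unique xs →
             (∀ {x} → x ∈ xs → g (f x) ≡ x) → Unique (map f xs)
Unique-map f g []                    retract = []
Unique-map f g {x ∷ xs} (x∉ ∷ uxs) retract =
  Allₚ.map⁺ (All.tabulate (λ y∈ fx≡fy → All.lookup x∉ y∈
    (≡.trans (≡.sym (retract (here ≡.refl))) (≡.trans (≡.cong g fx≡fy) (retract (there y∈))))))
  ∷ Unique-map f g uxs (retract ∘ there)

Positive : Comp → Set
Positive = IsComposition

comps-positive : ∀ n → All Positive (comps n)
comps-positive zero    = [] ∷ []
comps-positive (suc n) = Allₚ.concat⁺ (Allₚ.map⁺ (All.map step (comps-positive n)))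
  where
  step : ∀ {c} → Positive c → All Positive ((1 ∷ c) ∷ incFirst c)
  step []        = (s≤s z≤n ∷ []) ∷ []
  step (pa ∷ pc) = (s≤s z≤n ∷ pa ∷ pc) ∷ (s≤s z≤n ∷ pc) ∷ []

comps-sum : ∀ n → All (λ c → sum c ≡ n) (comps n)
comps-sum zero    = ≡.refl ∷ []
comps-sum (suc n) = Allₚ.concat⁺ (Allₚ.map⁺ (All.map step (comps-sum n)))
  where
  step : ∀ {c} → sum c ≡ n → All (λ c → sum c ≡ suc n) ((1 ∷ c) ∷ incFirst c)
  step {[]}    e = ≡.cong suc e ∷ []
  step {a ∷ c} e = ≡.cong suc e ∷ ≡.cong suc e ∷ []

comps-complete : ∀ {c} n → Positive c → sum c ≡ n → c ∈ comps n
comps-complete {[]} n [] ≡.refl = here ≡.refl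
comps-complete {zero ∷ c} n (() ∷ _) e
comps-complete {suc zero ∷ c} (suc n) (_ ∷ pc) e =
  ∈-concatMap⁺ (λ c → (1 ∷ c) ∷ incFirst c) {xs = comps n}
    (lose (comps-complete n pc (ℕₚ.suc-injective e)) (here ≡.refl))
comps-complete {suc (suc a) ∷ c} (suc n) (_ ∷ pc) e =
  ∈-concatMap⁺ (λ c → (1 ∷ c) ∷ incFirst c) {xs = comps n}
    (lose (comps-complete {suc a ∷ c} n (s≤s z≤n ∷ pc) (ℕₚ.suc-injective e)) (there (here ≡.refl)))

-- The first part tells how a composition arose: 1 was prepended, a larger part was increased.
-- `decrement` undoes either; positivity excludes a first part 0 that was increased to 1.
comps-unique : ∀ n → Unique (comps n)
comps-unique zero    = [] ∷ []
comps-unique (suc n) = Unique-concatMap _ decrement (comps-unique n) (λ {c} _ → distinct c)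
  (λ c∈ → retract (All.lookup (comps-positive n) c∈))
  where
  decrement : Comp → Comp
  decrement (suc zero    ∷ c) = c
  decrement (suc (suc a) ∷ c) = suc a ∷ c
  decrement c                 = c
  distinct : ∀ c → Unique ((1 ∷ c) ∷ incFirst c)
  distinct []          = [] ∷ []
  distinct (zero  ∷ c) = ((λ ()) ∷ []) ∷ [] ∷ []
  distinct (suc a ∷ c) = ((λ ()) ∷ []) ∷ [] ∷ []
  retract : ∀ {c d} → Positive c → d ∈ (1 ∷ c) ∷ incFirst c → decrement d ≡ c
  retract pc (here ≡.refl) = ≡.refl
  retract {suc a ∷ c} (_ ∷ pc) (there (here ≡.refl)) = ≡.refl

-- The words, with multiplicity, of M_γ^⊥ H_w: an increasing choice of positions of w from
-- which the parts of γ are subtracted.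
removals : Comp → Comp → List Comp
removals []      w       = w ∷ []
removals (g ∷ γ) []      = []
removals (g ∷ γ) (x ∷ w) =
  map (x ∷_) (removals (g ∷ γ) w) ++ (if g ≤ᵇ x then map (consH (x ∸ g)) (removals γ w) else [])

if-≤ : ∀ {g x} {s t : A} → g ≤ x → (if g ≤ᵇ x then s else t) ≡ s
if-≤ {g = g} {x} g≤x rewrite dec-true (g ℕₚ.≤? x) g≤x = ≡.refl

if-> : ∀ {g x} {s t : A} → x < g → (if g ≤ᵇ x then s else t) ≡ t
if-> {g = g} {x} x<g rewrite dec-false (g ℕₚ.≤? x) (ℕₚ.<⇒≱ x<g) = ≡.refl

consH-positive : ∀ x {w} → Positive w → Positive (consH x w)
consH-positive zero    pw = pw
consH-positive (suc x) pw = s≤s z≤n ∷ pw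

sum-consH : ∀ x w → sum (consH x w) ≡ x ℕ.+ sum w
sum-consH zero    w = ≡.refl
sum-consH (suc x) w = ≡.refl

removals-positive : ∀ γ {w} → Positive w → All Positive (removals γ w)
removals-positive []      pw        = pw ∷ []
removals-positive (g ∷ γ) []        = []
removals-positive (g ∷ γ) {x ∷ w} (px ∷ pw) =
  Allₚ.++⁺ (Allₚ.map⁺ (All.map (px ∷_) (removals-positive (g ∷ γ) pw))) rest
  where
  rest : All Positive (if g ≤ᵇ x then map (consH (x ∸ g)) (removals γ w) else [])
  rest with g ≤ᵇ x
  ... | true  = Allₚ.map⁺ (All.map (consH-positive (x ∸ g)) (removals-positive γ pw))
  ... | false = []

removals-sum : ∀ γ w → All (λ u → sum γ ℕ.+ sum u ≡ sum w) (removals γ w)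
removals-sum []      w       = ≡.refl ∷ []
removals-sum (g ∷ γ) []      = []
removals-sum (g ∷ γ) (x ∷ w) =
  Allₚ.++⁺ (Allₚ.map⁺ (All.map (λ {u} → kept {u}) (removals-sum (g ∷ γ) w))) rest
  where
  open ≡.≡-Reasoning
  open import Algebra.Properties.CommutativeSemigroup ℕₚ.+-commutativeSemigroup
    using (x∙yz≈y∙xz; interchange)
  kept : ∀ {u} → g ℕ.+ sum γ ℕ.+ sum u ≡ sum w → g ℕ.+ sum γ ℕ.+ (x ℕ.+ sum u) ≡ x ℕ.+ sum w
  kept {u} e = ≡.trans (x∙yz≈y∙xz (g ℕ.+ sum γ) x (sum u)) (≡.cong (x ℕ.+_) e)
  rest : All (λ u → g ℕ.+ sum γ ℕ.+ sum u ≡ x ℕ.+ sum w)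
             (if g ≤ᵇ x then map (consH (x ∸ g)) (removals γ w) else [])
  rest with g ℕₚ.≤? x
  ... | no g≰x rewrite if-> {s = map (consH (x ∸ g)) (removals γ w)} {t = []} (ℕₚ.≰⇒> g≰x) = []
  ... | yes g≤x rewrite if-≤ {s = map (consH (x ∸ g)) (removals γ w)} {t = []} g≤x =
    Allₚ.map⁺ (All.map (λ {u} → lowered {u}) (removals-sum γ w))
    where
    lowered : ∀ {u} → sum γ ℕ.+ sum u ≡ sum w → g ℕ.+ sum γ ℕ.+ sum (consH (x ∸ g) u) ≡ x ℕ.+ sum w
    lowered {u} e = begin
      g ℕ.+ sum γ ℕ.+ sum (consH (x ∸ g) u)    ≡⟨ ≡.cong (g ℕ.+ sum γ ℕ.+_) (sum-consH (x ∸ g) u) ⟩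
      g ℕ.+ sum γ ℕ.+ (x ∸ g ℕ.+ sum u)        ≡⟨ interchange g (sum γ) (x ∸ g) (sum u) ⟩
      g ℕ.+ (x ∸ g) ℕ.+ (sum γ ℕ.+ sum u)      ≡⟨ ≡.cong₂ ℕ._+_ (ℕₚ.m+[n∸m]≡n g≤x) e ⟩
      x ℕ.+ sum w                              ∎

-- A Kronecker delta times `n`. It keeps the comparison of first letters inside the term, so that
-- the three blocks of a quasi-shuffle can be permuted before any case distinction.
only : ℕ → ℕ → ℕ → ℕ
only x y n with x ℕ.≟ y
... | yes _ = n
... | no  _ = 0

only-≡ : ∀ x n → only x x n ≡ n
only-≡ x n with x ℕ.≟ x
... | yes _  = ≡.refl
... | no x≢x = ⊥-elim (x≢x ≡.refl)

only-≢ : ∀ {x y} n → x ≢ y → only x y n ≡ 0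
only-≢ {x} {y} n x≢y with x ℕ.≟ y
... | yes x≡y = ⊥-elim (x≢y x≡y)
... | no _    = ≡.refl

only-comm : ∀ x y n → only x y n ≡ only y x n
only-comm x y n with x ℕ.≟ y
... | yes ≡.refl = ≡.sym (only-≡ x n)
... | no x≢y     = ≡.sym (only-≢ n (x≢y ∘ ≡.sym))

only-+ : ∀ g x y n → only (g ℕ.+ x) (g ℕ.+ y) n ≡ only x y n
only-+ g x y n with x ℕ.≟ y
... | yes ≡.refl = only-≡ (g ℕ.+ x) n
... | no x≢y     = only-≢ n (x≢y ∘ ℕₚ.+-cancelˡ-≡ g x y)

countIn-++ : ∀ u vs ws → countIn u (vs ++ ws) ≡ countIn u vs ℕ.+ countIn u ws
countIn-++ u vs ws = ≡.trans (≡.cong length (filter-++ (≡-dec ℕ._≟_ u) vs ws))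
                             (length-++ (filter (≡-dec ℕ._≟_ u) vs))

countIn-≡ : ∀ {u v} ws → u ≡ v → countIn u (v ∷ ws) ≡ suc (countIn u ws)
countIn-≡ {u} ws u≡v = ≡.cong length (filter-accept (≡-dec ℕ._≟_ u) {xs = ws} u≡v)

countIn-≢ : ∀ {u v} ws → u ≢ v → countIn u (v ∷ ws) ≡ countIn u ws
countIn-≢ {u} ws u≢v = ≡.cong length (filter-reject (≡-dec ℕ._≟_ u) {xs = ws} u≢v)

countIn-map-∷ : ∀ x u y ws → countIn (x ∷ u) (map (y ∷_) ws) ≡ only x y (countIn u ws)
countIn-map-∷ x u y ws with x ℕ.≟ y
... | no x≢y = none ws
  where
  none : ∀ ws → countIn (x ∷ u) (map (y ∷_) ws) ≡ 0
  none []       = ≡.refl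
  none (w ∷ ws) = ≡.trans (countIn-≢ (map (y ∷_) ws) (x≢y ∘ ∷-injectiveˡ)) (none ws)
... | yes ≡.refl = same ws
  where
  same : ∀ ws → countIn (x ∷ u) (map (x ∷_) ws) ≡ countIn u ws
  same []       = ≡.refl
  same (w ∷ ws) = by-cases (≡-dec ℕ._≟_ u w)
    where
    open ≡.≡-Reasoning
    by-cases : Dec (u ≡ w) → countIn (x ∷ u) (map (x ∷_) (w ∷ ws)) ≡ countIn u (w ∷ ws)
    by-cases (yes u≡w) = begin
      countIn (x ∷ u) (map (x ∷_) (w ∷ ws))  ≡⟨ countIn-≡ (map (x ∷_) ws) (≡.cong (x ∷_) u≡w) ⟩
      suc (countIn (x ∷ u) (map (x ∷_) ws))  ≡⟨ ≡.cong suc (same ws) ⟩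
      suc (countIn u ws)                     ≡⟨ countIn-≡ ws u≡w ⟨
      countIn u (w ∷ ws)                     ∎
    by-cases (no u≢w) = begin
      countIn (x ∷ u) (map (x ∷_) (w ∷ ws))  ≡⟨ countIn-≢ (map (x ∷_) ws) (u≢w ∘ ∷-injectiveʳ) ⟩
      countIn (x ∷ u) (map (x ∷_) ws)        ≡⟨ same ws ⟩
      countIn u ws                           ≡⟨ countIn-≢ ws u≢w ⟨
      countIn u (w ∷ ws)                     ∎

countIn-[]-map-∷ : ∀ y ws → countIn [] (map (y ∷_) ws) ≡ 0
countIn-[]-map-∷ y []       = ≡.refl
countIn-[]-map-∷ y (w ∷ ws) = countIn-[]-map-∷ y ws

countIn-[_]-comm : ∀ u v → countIn u (v ∷ []) ≡ countIn v (u ∷ [])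
countIn-[_]-comm u v = by-cases (≡-dec ℕ._≟_ u v)
  where
  by-cases : Dec (u ≡ v) → countIn u (v ∷ []) ≡ countIn v (u ∷ [])
  by-cases (yes u≡v) = ≡.trans (countIn-≡ [] u≡v) (≡.sym (countIn-≡ [] (≡.sym u≡v)))
  by-cases (no  u≢v) = ≡.trans (countIn-≢ [] u≢v) (≡.sym (countIn-≢ [] (u≢v ∘ ≡.sym)))

countIn-removals-∷ : ∀ x w g γ u → countIn u (removals (g ∷ γ) (x ∷ w)) ≡
  countIn u (map (x ∷_) (removals (g ∷ γ) w)) ℕ.+
  countIn u (if g ≤ᵇ x then map (consH (x ∸ g)) (removals γ w) else [])
countIn-removals-∷ x w g γ u = countIn-++ u (map (x ∷_) (removals (g ∷ γ) w)) _

-- The case δ = [] of the duality: subtracting γ leaves the empty word only if each part of w is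
-- used up exactly by the corresponding part of γ.
countIn-removals-[] : ∀ γ w → countIn w (γ ∷ []) ≡ countIn [] (removals γ w)
countIn-removals-[] []      w       = countIn-[ w ]-comm []
countIn-removals-[] (g ∷ γ) []      = ≡.refl
countIn-removals-[] (g ∷ γ) (x ∷ w) = begin
  countIn (x ∷ w) (map (g ∷_) (γ ∷ []))
    ≡⟨ countIn-map-∷ x w g (γ ∷ []) ⟩
  only x g (countIn w (γ ∷ []))
    ≡⟨ lowered (ℕₚ.<-cmp x g) ⟩
  countIn [] (if g ≤ᵇ x then map (consH (x ∸ g)) (removals γ w) else [])
    ≡⟨ ≡.cong (ℕ._+ countIn [] (if g ≤ᵇ x then map (consH (x ∸ g)) (removals γ w) else []))
              (countIn-[]-map-∷ x (removals (g ∷ γ) w)) ⟨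
  countIn [] (map (x ∷_) (removals (g ∷ γ) w)) ℕ.+
    countIn [] (if g ≤ᵇ x then map (consH (x ∸ g)) (removals γ w) else [])
    ≡⟨ countIn-removals-∷ x w g γ [] ⟨
  countIn [] (removals (g ∷ γ) (x ∷ w)) ∎
  where
  open ≡.≡-Reasoning
  lowered : Tri (x < g) (x ≡ g) (g < x) → only x g (countIn w (γ ∷ [])) ≡
            countIn [] (if g ≤ᵇ x then map (consH (x ∸ g)) (removals γ w) else [])
  lowered (tri< x<g x≢g _)
    rewrite if-> {s = map (consH (x ∸ g)) (removals γ w)} {t = []} x<g = only-≢ _ x≢g
  lowered (tri≈ _ ≡.refl _)
    rewrite if-≤ {s = map (consH (x ∸ x)) (removals γ w)} {t = []} (ℕₚ.≤-refl {x})
          | ℕₚ.n∸n≡0 x | map-id (removals γ w) =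
    ≡.trans (only-≡ x _) (countIn-removals-[] γ w)
  lowered (tri> _ x≢g g<x)
    rewrite if-≤ {s = map (consH (x ∸ g)) (removals γ w)} {t = []} (ℕₚ.<⇒≤ g<x)
    with x ∸ g | ℕₚ.m<n⇒0<n∸m g<x
  ... | suc k | _ = ≡.trans (only-≢ _ x≢g) (≡.sym (countIn-[]-map-∷ (suc k) (removals γ w)))

-- The first letter x of w has three possible origins in the quasi-shuffle. If it comes from δ, it
-- is a part that is kept; if from γ, a part lowered to 0 and dropped; if merged, a part lowered by
-- g to y. Since y > 0, the last two origins exclude each other.
countIn-qsh : ∀ γ {δ} → Positive δ → ∀ w → countIn w (qsh γ δ) ≡ countIn δ (removals γ w)
countIn-qsh []      {δ} pδ       w = countIn-[ w ]-comm δ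
countIn-qsh (g ∷ γ) []        w = countIn-removals-[] (g ∷ γ) w
countIn-qsh (g ∷ γ) {y ∷ δ} (py ∷ pδ) [] = begin
  countIn [] (qsh (g ∷ γ) (y ∷ δ))
    ≡⟨ countIn-++ [] (map (g ∷_) (qsh γ (y ∷ δ))) _ ⟩
  countIn [] (map (g ∷_) (qsh γ (y ∷ δ))) ℕ.+
    countIn [] (map (y ∷_) (qsh (g ∷ γ) δ) ++ map (g ℕ.+ y ∷_) (qsh γ δ))
    ≡⟨ ≡.cong₂ ℕ._+_ (countIn-[]-map-∷ g (qsh γ (y ∷ δ)))
         (countIn-++ [] (map (y ∷_) (qsh (g ∷ γ) δ)) _) ⟩
  countIn [] (map (y ∷_) (qsh (g ∷ γ) δ)) ℕ.+ countIn [] (map (g ℕ.+ y ∷_) (qsh γ δ))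
    ≡⟨ ≡.cong₂ ℕ._+_ (countIn-[]-map-∷ y (qsh (g ∷ γ) δ))
         (countIn-[]-map-∷ (g ℕ.+ y) (qsh γ δ)) ⟩
  0 ∎
  where open ≡.≡-Reasoning
countIn-qsh (g ∷ γ) {y ∷ δ} (py ∷ pδ) (x ∷ w) = begin
  countIn (x ∷ w) (qsh (g ∷ γ) (y ∷ δ))
    ≡⟨ countIn-++ (x ∷ w) (map (g ∷_) (qsh γ (y ∷ δ))) _ ⟩
  countIn (x ∷ w) (map (g ∷_) (qsh γ (y ∷ δ))) ℕ.+
    countIn (x ∷ w) (map (y ∷_) (qsh (g ∷ γ) δ) ++ map (g ℕ.+ y ∷_) (qsh γ δ))
    ≡⟨ ≡.cong₂ ℕ._+_ (countIn-map-∷ x w g (qsh γ (y ∷ δ)))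
         (≡.trans (countIn-++ (x ∷ w) (map (y ∷_) (qsh (g ∷ γ) δ)) _)
           (≡.cong₂ ℕ._+_ (countIn-map-∷ x w y (qsh (g ∷ γ) δ))
                          (countIn-map-∷ x w (g ℕ.+ y) (qsh γ δ)))) ⟩
  only x g (countIn w (qsh γ (y ∷ δ))) ℕ.+
    (only x y (countIn w (qsh (g ∷ γ) δ)) ℕ.+ only x (g ℕ.+ y) (countIn w (qsh γ δ)))
    ≡⟨ ≡.cong₂ ℕ._+_ (≡.cong (only x g) (countIn-qsh γ (py ∷ pδ) w))
         (≡.cong₂ ℕ._+_ (≡.cong (only x y) (countIn-qsh (g ∷ γ) pδ w))
                        (≡.cong (only x (g ℕ.+ y)) (countIn-qsh γ pδ w))) ⟩
  only x g (countIn (y ∷ δ) (removals γ w)) ℕ.+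
    (only x y (countIn δ (removals (g ∷ γ) w)) ℕ.+ only x (g ℕ.+ y) (countIn δ (removals γ w)))
    ≡⟨ x∙yz≈y∙xz (only x g (countIn (y ∷ δ) (removals γ w)))
                   (only x y (countIn δ (removals (g ∷ γ) w)))
                   (only x (g ℕ.+ y) (countIn δ (removals γ w))) ⟩
  only x y (countIn δ (removals (g ∷ γ) w)) ℕ.+
    (only x g (countIn (y ∷ δ) (removals γ w)) ℕ.+ only x (g ℕ.+ y) (countIn δ (removals γ w)))
    ≡⟨ ≡.cong₂ ℕ._+_
         (≡.trans (only-comm x y _) (≡.sym (countIn-map-∷ y δ x (removals (g ∷ γ) w))))
         (lowered (ℕₚ.<-cmp x g)) ⟩
  countIn (y ∷ δ) (map (x ∷_) (removals (g ∷ γ) w)) ℕ.+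
    countIn (y ∷ δ) (if g ≤ᵇ x then map (consH (x ∸ g)) (removals γ w) else [])
    ≡⟨ countIn-removals-∷ x w g γ (y ∷ δ) ⟨
  countIn (y ∷ δ) (removals (g ∷ γ) (x ∷ w)) ∎
  where
  open ≡.≡-Reasoning
  open import Algebra.Properties.CommutativeSemigroup ℕₚ.+-commutativeSemigroup using (x∙yz≈y∙xz)
  x<g+y : x ≤ g → x < g ℕ.+ y
  x<g+y x≤g = ℕₚ.≤-<-trans x≤g (ℕₚ.m<m+n g py)
  lowered : Tri (x < g) (x ≡ g) (g < x) →
    only x g (countIn (y ∷ δ) (removals γ w)) ℕ.+ only x (g ℕ.+ y) (countIn δ (removals γ w)) ≡
    countIn (y ∷ δ) (if g ≤ᵇ x then map (consH (x ∸ g)) (removals γ w) else [])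
  lowered (tri< x<g x≢g _)
    rewrite if-> {s = map (consH (x ∸ g)) (removals γ w)} {t = []} x<g =
    ≡.cong₂ ℕ._+_ (only-≢ _ x≢g) (only-≢ _ (ℕₚ.<⇒≢ (x<g+y (ℕₚ.<⇒≤ x<g))))
  lowered (tri≈ _ ≡.refl _)
    rewrite if-≤ {s = map (consH (x ∸ x)) (removals γ w)} {t = []} (ℕₚ.≤-refl {x})
          | ℕₚ.n∸n≡0 x | map-id (removals γ w) =
    ≡.trans (≡.cong₂ ℕ._+_ (only-≡ x _) (only-≢ _ (ℕₚ.<⇒≢ (x<g+y ℕₚ.≤-refl)))) (ℕₚ.+-identityʳ _)
  lowered (tri> _ x≢g g<x)
    rewrite if-≤ {s = map (consH (x ∸ g)) (removals γ w)} {t = []} (ℕₚ.<⇒≤ g<x)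
    -- Exposing `x ∸ g` as a successor makes `consH` reduce to `_∷_` and turns x into `g ℕ.+ suc k`.
    with x ∸ g | ℕₚ.m<n⇒0<n∸m g<x | ℕₚ.m+[n∸m]≡n (ℕₚ.<⇒≤ g<x)
  ... | suc k | _ | ≡.refl = begin
    only x g _ ℕ.+ only x (g ℕ.+ y) C  ≡⟨ ≡.cong (ℕ._+ only x (g ℕ.+ y) C) (only-≢ _ x≢g) ⟩
    only (g ℕ.+ suc k) (g ℕ.+ y) C     ≡⟨ only-+ g (suc k) y C ⟩
    only (suc k) y C                   ≡⟨ only-comm (suc k) y C ⟩
    only y (suc k) C                   ≡⟨ countIn-map-∷ y δ (suc k) (removals γ w) ⟨
    countIn (y ∷ δ) (map (suc k ∷_) (removals γ w)) ∎
    where C = countIn δ (removals γ w)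

-- Skewing by the series of F_{1ⁱ} and of F_i, expressed by one-variable factors

module RemovalSums (R : CommutativeRing 0ℓ 0ℓ) where
  open CommutativeRing R renaming (Carrier to K)
  open FiniteSums R
  open Skewing R
  open SetoidReasoning setoid
  open import Algebra.Properties.Ring ring using (-‿distribˡ-*)

  ∑-removals-too-large : ∀ γ w φ → sum w < sum γ → ∑∈ (removals γ w) φ ≈ 0#
  ∑-removals-too-large γ w φ w<γ with removals γ w | removals-sum γ w
  ... | []     | _     = refl
  ... | u ∷ us | e ∷ _ = ⊥-elim (ℕₚ.<⇒≱ w<γ (≡.subst (sum γ ≤_) e (ℕₚ.m≤m+n (sum γ) (sum u))))

  ∑-removals-∷ : ∀ g γ x w φ → ∑∈ (removals (g ∷ γ) (x ∷ w)) φ ≈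
    ∑∈ (removals (g ∷ γ) w) (φ ∘ (x ∷_)) +
    (if g ≤ᵇ x then ∑∈ (removals γ w) (φ ∘ consH (x ∸ g)) else 0#)
  ∑-removals-∷ g γ x w φ = trans
    (∑∈-++ φ (map (x ∷_) (removals (g ∷ γ) w)) _)
    (+-cong (∑∈-map φ (x ∷_) (removals (g ∷ γ) w)) lowered)
    where
    lowered : ∑∈ (if g ≤ᵇ x then map (consH (x ∸ g)) (removals γ w) else []) φ ≈
              (if g ≤ᵇ x then ∑∈ (removals γ w) (φ ∘ consH (x ∸ g)) else 0#)
    lowered with g ≤ᵇ x
    ... | true  = ∑∈-map φ (consH (x ∸ g)) (removals γ w)
    ... | false = refl

  sign : ℕ → K
  sign zero    = 1#
  sign (suc i) = - sign i

  private
    shift : ∀ (Φ : ℕ → Comp → K) i j n u → Φ (i ℕ.+ (j ℕ.+ n)) u ≈ Φ (j ℕ.+ i ℕ.+ n) u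
    shift Φ i j n u = reflexive (≡.cong (λ m → Φ m u)
      (≡.trans (≡.sym (ℕₚ.+-assoc i j n)) (≡.cong (ℕ._+ n) (ℕₚ.+-comm i j))))

  -- Σ (-1)ⁱ F_{1ⁱ} is Π (1 - x_i): each part is kept, or loses one unit and contributes a sign. The
  -- bound N is free above `sum w` because one truncation has to serve all words of an element.
  ∑-altE : ∀ N Φ n {w} → Positive w → sum w ≤ N →
    ∑≤ N (λ i → sign i * ∑∈ (removals (replicate i 1) w) (Φ (i ℕ.+ n))) ≈ skew (altE) Φ n w
  ∑-altE N Φ n []  _ = begin
    ∑≤ N (λ i → sign i * ∑∈ (removals (replicate i 1) []) (Φ (i ℕ.+ n)))
      ≈⟨ ∑≤-extend {n = N} (λ i → sign i * ∑∈ (removals (replicate i 1) []) (Φ (i ℕ.+ n)))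
           z≤n (λ { (s≤s _) → zeroʳ _ }) ⟩
    1# * (Φ n [] + 0#)  ≈⟨ trans (*-identityˡ _) (+-identityʳ _) ⟩
    Φ n []              ∎
  ∑-altE (suc N) Φ n {suc x ∷ w} (_ ∷ pw) (s≤s ≤N) = begin
    1# * (Φ n (suc x ∷ w) + 0#) +
      ∑≤ N (λ i → - sign i * ∑∈ (removals (1 ∷ replicate i 1) (suc x ∷ w)) (Φ (suc i ℕ.+ n)))
      ≈⟨ +-congˡ (∑≤-cong N (λ i → trans
           (*-congˡ (∑-removals-∷ 1 (replicate i 1) (suc x) w (Φ (suc i ℕ.+ n))))
           (distribˡ (- sign i) _ _))) ⟩
    kept 0 + ∑≤ N (λ i → kept (suc i) + lowered i)
      ≈⟨ +-congˡ (∑≤-+ N (kept ∘ suc) lowered) ⟩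
    kept 0 + (∑≤ N (kept ∘ suc) + ∑≤ N lowered)
      ≈⟨ +-assoc _ _ _ ⟨
    ∑≤ (suc N) kept + ∑≤ N lowered
      ≈⟨ +-cong (trans (∑-altE (suc N) (λ k u → Φ k (suc x ∷ u)) n pw
                          (ℕₚ.≤-trans (ℕₚ.m≤n+m (sum w) x) (ℕₚ.m≤n⇒m≤1+n ≤N)))
                       (sym (*-identityˡ _)))
                (trans (trans (∑≤-cong N negate) (sym (∑≤-distribˡ N (- 1#) lowered′)))
                  (*-congˡ (trans (∑≤-cong N (λ i → *-congˡ (∑∈-cong (removals (replicate i 1) w)
                     (λ u → sym (shift (λ k u → Φ k (consH x u)) i 1 n u)))))
                    (∑-altE N (λ k u → Φ k (consH x u)) (suc n) pw
                      (ℕₚ.≤-trans (ℕₚ.m≤n+m (sum w) x) ≤N))))) ⟩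
    S 0 + S 1
      ≈⟨ ∑≤-extend {n = suc x} S (s≤s z≤n) (λ { (s≤s (s≤s _)) → zeroˡ _ }) ⟨
    ∑≤ (suc x) S ∎
    where
    S kept lowered lowered′ : ℕ → K
    S j = altE j * skew (altE) (λ k u → Φ k (consH (suc x ∸ j) u)) (j ℕ.+ n) w
    kept i = sign i * ∑∈ (removals (replicate i 1) w) (λ u → Φ (i ℕ.+ n) (suc x ∷ u))
    lowered i = - sign i * ∑∈ (removals (replicate i 1) w) (λ u → Φ (suc i ℕ.+ n) (consH x u))
    lowered′ i = sign i * ∑∈ (removals (replicate i 1) w) (λ u → Φ (suc i ℕ.+ n) (consH x u))
    negate : ∀ i → lowered i ≈ - 1# * lowered′ i
    negate i = trans (*-congʳ (trans (-‿cong (sym (*-identityˡ (sign i)))) (-‿distribˡ-* 1# (sign i))))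
                     (*-assoc (- 1#) (sign i) _)

  -- Regroups the compositions by first part `suc g`, the form that the recursion of `removals`
  -- consumes. In the induction, `incFirst` raises the index g by one.
  ∑-comps-suc : ∀ (ψ : Comp → K) n →
    ∑∈ (comps (suc n)) ψ ≈ ∑≤ n (λ g → ∑∈ (comps (n ∸ g)) (ψ ∘ (suc g ∷_)))
  ∑-comps-suc ψ zero    = refl
  ∑-comps-suc ψ (suc n) = begin
    ∑∈ (comps (suc (suc n))) ψ
      ≈⟨ ∑∈-concatMap ψ (λ c → (1 ∷ c) ∷ incFirst c) (comps (suc n)) ⟩
    ∑∈ (comps (suc n)) (λ c → ψ (1 ∷ c) + ∑∈ (incFirst c) ψ)
      ≈⟨ ∑∈-+ (ψ ∘ (1 ∷_)) _ (comps (suc n)) ⟩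
    ∑∈ (comps (suc n)) (ψ ∘ (1 ∷_)) + ∑∈ (comps (suc n)) (λ c → ∑∈ (incFirst c) ψ)
      ≈⟨ +-congˡ (∑-comps-suc (λ c → ∑∈ (incFirst c) ψ) n) ⟩
    ∑∈ (comps (suc n)) (ψ ∘ (1 ∷_)) + ∑≤ n (λ g → ∑∈ (comps (n ∸ g)) (λ c → ψ (suc (suc g) ∷ c) + 0#))
      ≈⟨ +-congˡ (∑≤-cong n (λ g → ∑∈-cong (comps (n ∸ g)) (λ c → +-identityʳ _))) ⟩
    ∑∈ (comps (suc n)) (ψ ∘ (1 ∷_)) + ∑≤ n (λ g → ∑∈ (comps (n ∸ g)) (ψ ∘ (suc (suc g) ∷_))) ∎

  -- The value of the functional `φ` on F_i^⊥ H_w.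
  F⊥ : ℕ → Comp → (Comp → K) → K
  F⊥ i w φ = ∑∈ (comps i) (λ γ → ∑∈ (removals γ w) φ)

  F⊥-cong : ∀ i w {φ ψ} → (∀ u → φ u ≈ ψ u) → F⊥ i w φ ≈ F⊥ i w ψ
  F⊥-cong i w e = ∑∈-cong (comps i) (λ γ → ∑∈-cong (removals γ w) e)

  -- F_i is the complete homogeneous function h_i, with coproduct Σ h_g ⊗ h_{i-g}: g units come off
  -- the first part and i - g off the others. The term g = 0 collects the removals that keep the
  -- first part.
  F⊥-∷ : ∀ i x w φ → F⊥ i (suc x ∷ w) φ ≈
    ∑≤ i (λ g → if g ≤ᵇ suc x then F⊥ (i ∸ g) w (φ ∘ consH (suc x ∸ g)) else 0#)
  F⊥-∷ zero    x w φ = refl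
  F⊥-∷ (suc i) x w φ = begin
    F⊥ (suc i) (suc x ∷ w) φ
      ≈⟨ ∑-comps-suc (λ γ → ∑∈ (removals γ (suc x ∷ w)) φ) i ⟩
    ∑≤ i (λ g → ∑∈ (comps (i ∸ g)) (λ γ → ∑∈ (removals (suc g ∷ γ) (suc x ∷ w)) φ))
      ≈⟨ ∑≤-cong i (λ g → trans (∑∈-cong (comps (i ∸ g)) (λ γ → ∑-removals-∷ (suc g) γ (suc x) w φ))
                                (∑∈-+ (kept g) _ (comps (i ∸ g)))) ⟩
    ∑≤ i (λ g → ∑∈ (comps (i ∸ g)) (kept g) + ∑∈ (comps (i ∸ g)) (lowered g))
      ≈⟨ ∑≤-+ i _ _ ⟩
    ∑≤ i (λ g → ∑∈ (comps (i ∸ g)) (kept g)) + ∑≤ i (λ g → ∑∈ (comps (i ∸ g)) (lowered g))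
      ≈⟨ +-cong (sym (∑-comps-suc (λ γ → ∑∈ (removals γ w) (φ ∘ (suc x ∷_))) i))
                (∑≤-cong i collect) ⟩
    ∑≤ (suc i) (λ g → if g ≤ᵇ suc x then F⊥ (suc i ∸ g) w (φ ∘ consH (suc x ∸ g)) else 0#) ∎
    where
    kept lowered : ℕ → Comp → K
    kept g γ = ∑∈ (removals (suc g ∷ γ) w) (φ ∘ (suc x ∷_))
    lowered g γ = if suc g ≤ᵇ suc x then ∑∈ (removals γ w) (φ ∘ consH (x ∸ g)) else 0#
    collect : ∀ g → ∑∈ (comps (i ∸ g)) (lowered g) ≈
                    (if suc g ≤ᵇ suc x then F⊥ (i ∸ g) w (φ ∘ consH (x ∸ g)) else 0#)
    collect g with suc g ≤ᵇ suc x
    ... | true  = refl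
    ... | false = ∑∈-zero (comps (i ∸ g))

  qPow-+ : ∀ q i j → qPow q (i ℕ.+ j) ≈ qPow q i * qPow q j
  qPow-+ q zero    j = sym (*-identityˡ _)
  qPow-+ q (suc i) j = trans (*-congˡ (qPow-+ q i j)) (sym (*-assoc _ _ _))

  -- Σ qⁱ F_i is Π 1/(1 - q x_i). After g units are taken from the first part, the bound `N ∸ g`
  -- still dominates the size of the rest, so the induction applies to each g separately.
  ∑-qPow : ∀ q N Φ n {w} → Positive w → sum w ≤ N →
    ∑≤ N (λ i → qPow q i * F⊥ i w (Φ (i ℕ.+ n))) ≈ skew (qPow q) Φ n w
  ∑-qPow q N Φ n [] _ = begin
    ∑≤ N (λ i → qPow q i * F⊥ i [] (Φ (i ℕ.+ n)))
      ≈⟨ ∑≤-extend {n = N} (λ i → qPow q i * F⊥ i [] (Φ (i ℕ.+ n))) z≤n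
           (λ { {suc i} _ → trans (*-congˡ (empty i)) (zeroʳ _) }) ⟩
    1# * (Φ n [] + 0# + 0#)  ≈⟨ trans (*-identityˡ _) (trans (+-identityʳ _) (+-identityʳ _)) ⟩
    Φ n []                   ∎
    where
    empty : ∀ i → F⊥ (suc i) [] (Φ (suc i ℕ.+ n)) ≈ 0#
    empty i = trans (∑-comps-suc (λ γ → ∑∈ (removals γ []) (Φ (suc i ℕ.+ n))) i)
                    (trans (∑≤-cong i (λ g → ∑∈-zero (comps (i ∸ g)))) (∑≤-zero i))
  ∑-qPow q N Φ n {suc x ∷ w} (_ ∷ pw) ≤N = begin
    ∑≤ N (λ i → qPow q i * F⊥ i (suc x ∷ w) (Φ (i ℕ.+ n)))
      ≈⟨ ∑≤-cong N (λ i → trans (*-congˡ (F⊥-∷ i x w (Φ (i ℕ.+ n))))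
           (trans (∑≤-distribˡ i (qPow q i) _)
             -- Writing i as g + (i ∸ g) makes the summand a function of the pair (g, i ∸ g), so the
             -- triangle can be summed over g on the outside.
             (∑≤-cong-≤ i (λ {g} g≤i → reflexive (≡.cong (λ k →
               qPow q k * (if g ≤ᵇ suc x then F⊥ (i ∸ g) w (λ u → Φ (k ℕ.+ n) (consH (suc x ∸ g) u)) else 0#))
               (≡.sym (ℕₚ.m+[n∸m]≡n g≤i))))))) ⟩
    ∑≤ N (λ i → ∑≤ i (λ g → term g (i ∸ g)))
      ≈⟨ ∑≤-antidiagonal N term ⟨
    ∑≤ N (λ g → ∑≤ (N ∸ g) (term g))
      ≈⟨ ∑≤-extend {n = N} (λ g → ∑≤ (N ∸ g) (term g)) (ℕₚ.m+n≤o⇒m≤o (suc x) ≤N)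
           (λ {g} x<g → trans (∑≤-cong (N ∸ g) (λ i → trans
              (*-congˡ (reflexive (if-> x<g))) (zeroʳ _))) (∑≤-zero (N ∸ g))) ⟩
    ∑≤ (suc x) (λ g → ∑≤ (N ∸ g) (term g))
      ≈⟨ ∑≤-cong-≤ (suc x) inner ⟩
    ∑≤ (suc x) (λ g → qPow q g * skew (qPow q) (λ k u → Φ k (consH (suc x ∸ g) u)) (g ℕ.+ n) w) ∎
    where
    term : ℕ → ℕ → K
    term g i = qPow q (g ℕ.+ i) *
      (if g ≤ᵇ suc x then F⊥ i w (λ u → Φ (g ℕ.+ i ℕ.+ n) (consH (suc x ∸ g) u)) else 0#)
    inner : ∀ {g} → g ≤ suc x → ∑≤ (N ∸ g) (term g) ≈
            qPow q g * skew (qPow q) (λ k u → Φ k (consH (suc x ∸ g) u)) (g ℕ.+ n) w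
    inner {g} g≤x = begin
      ∑≤ (N ∸ g) (term g)
        ≈⟨ ∑≤-cong (N ∸ g) (λ i → trans (*-cong (qPow-+ q g i) (trans (reflexive (if-≤ g≤x))
             (F⊥-cong i w (λ u → sym (shift (λ k u → Φ k (consH (suc x ∸ g) u)) i g n u)))))
             (*-assoc (qPow q g) (qPow q i) _)) ⟩
      ∑≤ (N ∸ g) (λ i → qPow q g * (qPow q i * F⊥ i w (λ u → Φ (i ℕ.+ (g ℕ.+ n)) (consH (suc x ∸ g) u))))
        ≈⟨ ∑≤-distribˡ (N ∸ g) (qPow q g) _ ⟨
      qPow q g * ∑≤ (N ∸ g) (λ i → qPow q i * F⊥ i w (λ u → Φ (i ℕ.+ (g ℕ.+ n)) (consH (suc x ∸ g) u)))
        ≈⟨ *-congˡ (∑-qPow q (N ∸ g) (λ k u → Φ k (consH (suc x ∸ g) u)) (g ℕ.+ n) pw w≤N∸g) ⟩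
      qPow q g * skew (qPow q) (λ k u → Φ k (consH (suc x ∸ g) u)) (g ℕ.+ n) w ∎
      where
      w≤N∸g : sum w ≤ N ∸ g
      w≤N∸g = ℕₚ.≤-trans (≡.subst (_≤ N ∸ suc x) (ℕₚ.m+n∸m≡n (suc x) (sum w))
                            (ℕₚ.∸-monoˡ-≤ (suc x) ≤N))
                         (ℕₚ.∸-monoʳ-≤ N g≤x)

-- Immaculate tableaux

distribute : ∀ {n} → ℕ → ℕ → ℕ → List ℕ × Vec ℕ n → List ℕ × Vec ℕ (suc n)
distribute s x j (r , d) = replicate j s ++ r , (x ∸ j) ∷ d

-- A split consists of the letters that enter the row, in increasing order, and the copies left for
-- lower rows. Exhausted letters remain in the vector as zeros.
splits : ∀ {n} → ℕ → Vec ℕ n → List (List ℕ × Vec ℕ n)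
splits s []      = ([] , []) ∷ []
splits s (x ∷ c) = concatMap (λ j → map (distribute s x j) (splits (suc s) c)) (upTo (suc x))

-- The immaculate tableaux with c₀ entries s, c₁ entries s + 1, …, built row by row: all the entries s
-- lie in the first row, and a split of the rest of c says how many of each larger entry join them.
tableaux : ∀ {n} → ℕ → Vec ℕ n → List Tableau
tableaux s []           = [] ∷ []
tableaux s (zero  ∷ c)  = tableaux (suc s) c
tableaux s (suc b ∷ c)  = concatMap
  (λ rd → map ((replicate (suc b) s ++ proj₁ rd) ∷_) (tableaux (suc s) (proj₂ rd))) (splits (suc s) c)

Sorted : List ℕ → Set
Sorted = AllPairs _≤_

InRange : ℕ → ℕ → List ℕ → Set
InRange s n = All (λ x → s ≤ x × x < s ℕ.+ n)

contents : ∀ n → ℕ → List ℕ → Vec ℕ n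
contents zero    s w = []
contents (suc n) s w = countVal s w ∷ contents n (suc s) w

countVal-++ : ∀ i u w → countVal i (u ++ w) ≡ countVal i u ℕ.+ countVal i w
countVal-++ i u w = ≡.trans (≡.cong length (filter-++ (ℕ._≟ i) u w)) (length-++ (filter (ℕ._≟ i) u))

countVal-≡ : ∀ {i x} w → x ≡ i → countVal i (x ∷ w) ≡ suc (countVal i w)
countVal-≡ {i} w x≡i = ≡.cong length (filter-accept (ℕ._≟ i) {xs = w} x≡i)

countVal-≢ : ∀ {i x} w → x ≢ i → countVal i (x ∷ w) ≡ countVal i w
countVal-≢ {i} w x≢i = ≡.cong length (filter-reject (ℕ._≟ i) {xs = w} x≢i)

countVal-absent : ∀ {i w} → All (_≢ i) w → countVal i w ≡ 0
countVal-absent []           = ≡.refl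
countVal-absent (x≢i ∷ w≢i) = ≡.trans (countVal-≢ _ x≢i) (countVal-absent w≢i)

countVal-replicate : ∀ i j → countVal i (replicate j i) ≡ j
countVal-replicate i zero    = ≡.refl
countVal-replicate i (suc j) = ≡.trans (countVal-≡ {i} _ ≡.refl) (≡.cong suc (countVal-replicate i j))

absent : ∀ {i} w → countVal i w ≡ 0 → All (_≢ i) w
absent []          e = []
absent {i} (x ∷ w) e = x≢i ∷ absent w (≡.trans (≡.sym (countVal-≢ w x≢i)) e)
  where
  x≢i : x ≢ i
  x≢i x≡i with () ← ≡.trans (≡.sym (countVal-≡ w x≡i)) e

>⇒absent : ∀ {i w} → All (i <_) w → countVal i w ≡ 0
>⇒absent w>i = countVal-absent (All.map ℕₚ.>⇒≢ w>i)

contents-++ : ∀ n s u w → contents n s (u ++ w) ≡ zipWith ℕ._+_ (contents n s u) (contents n s w)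
contents-++ zero    s u w = ≡.refl
contents-++ (suc n) s u w = ≡.cong₂ _∷_ (countVal-++ s u w) (contents-++ n (suc s) u w)

contents-small : ∀ n {s i} j w → i < s → contents n s (replicate j i ++ w) ≡ contents n s w
contents-small zero    j w i<s = ≡.refl
contents-small (suc n) {s} {i} j w i<s = ≡.cong₂ _∷_
  (≡.trans (countVal-++ s (replicate j i) w)
    (≡.cong (ℕ._+ countVal s w) (countVal-absent (Allₚ.replicate⁺ j (ℕₚ.<⇒≢ i<s)))))
  (contents-small n j w (ℕₚ.m≤n⇒m≤1+n i<s))

InRange-suc : ∀ {s n w} → InRange (suc s) n w → InRange s (suc n) w
InRange-suc {s} {n} = All.map (λ {x} (s<x , x<) →
  ℕₚ.<⇒≤ s<x , ≡.subst (x <_) (≡.sym (ℕₚ.+-suc s n)) x<)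

InRange-pred : ∀ {s n w} → InRange s (suc n) w → All (s <_) w → InRange (suc s) n w
InRange-pred {s} {n} r s< = All.zipWith (λ {x} ((_ , x<) , s<x) →
  s<x , ≡.subst (x <_) (ℕₚ.+-suc s n) x<) (r , s<)

InRange-replicate : ∀ s n j → InRange s (suc n) (replicate j s)
InRange-replicate s n j = Allₚ.replicate⁺ j (ℕₚ.≤-refl , ℕₚ.m<m+n s (s≤s z≤n))

InRange⇒> : ∀ {s n w} → InRange (suc s) n w → All (s <_) w
InRange⇒> = All.map proj₁

Sorted-replicate-++ : ∀ s j {r} → Sorted r → All (s <_) r → Sorted (replicate j s ++ r)
Sorted-replicate-++ s zero    sr s<r = sr
Sorted-replicate-++ s (suc j) sr s<r =
  Allₚ.++⁺ (Allₚ.replicate⁺ j ℕₚ.≤-refl) (All.map ℕₚ.<⇒≤ s<r) ∷ Sorted-replicate-++ s j sr s<r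

contents-replicate-++ : ∀ n s j {r} → All (s <_) r →
  contents (suc n) s (replicate j s ++ r) ≡ j ∷ contents n (suc s) r
contents-replicate-++ n s j {r} s<r = ≡.cong₂ _∷_
  (≡.trans (countVal-++ s (replicate j s) r)
    (≡.trans (≡.cong₂ ℕ._+_ (countVal-replicate s j) (>⇒absent s<r)) (ℕₚ.+-identityʳ j)))
  (contents-small n j r ℕₚ.≤-refl)

-- Inverts the construction of a row: the copies of the smallest possible letter stand in front.
leading-entries : ∀ s {r} → Sorted r → All (s ≤_) r →
  ∃ λ r′ → r ≡ replicate (countVal s r) s ++ r′ × Sorted r′ × All (s <_) r′
leading-entries s {[]}    []        []        = [] , ≡.refl , [] , []
leading-entries s {x ∷ r} (x≤r ∷ sr) (s≤x ∷ s≤r) = by-cases (x ℕ.≟ s)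
  where
  by-cases : Dec (x ≡ s) →
    ∃ λ r′ → x ∷ r ≡ replicate (countVal s (x ∷ r)) s ++ r′ × Sorted r′ × All (s <_) r′
  by-cases (yes ≡.refl) with r′ , e , sr′ , s<r′ ← leading-entries s sr s≤r =
    r′ , ≡.trans (≡.cong (s ∷_) e)
           (≡.cong (λ k → replicate k s ++ r′) (≡.sym (countVal-≡ {s} r ≡.refl))) , sr′ , s<r′
  by-cases (no x≢s) = x ∷ r ,
    ≡.cong (λ k → replicate k s ++ x ∷ r) (≡.sym (>⇒absent s<xr)) , x≤r ∷ sr , s<xr
    where
    s<x : s < x
    s<x = ℕₚ.≤∧≢⇒< s≤x (x≢s ∘ ≡.sym)
    s<xr : All (s <_) (x ∷ r)
    s<xr = s<x ∷ All.map (ℕₚ.<-≤-trans s<x) x≤r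

record Split {n} (s : ℕ) (c : Vec ℕ n) (rd : List ℕ × Vec ℕ n) : Set where
  constructor split
  field
    row-sorted  : Sorted (proj₁ rd)
    row-range   : InRange s n (proj₁ rd)
    row-content : zipWith ℕ._+_ (contents n s (proj₁ rd)) (proj₂ rd) ≡ c
open Split

∈-concatMap-map⁺ : ∀ {C : Set} (f : A → B → C) (ys : A → List B) {xs x y} → x ∈ xs → y ∈ ys x →
                   f x y ∈ concatMap (λ x → map (f x) (ys x)) xs
∈-concatMap-map⁺ f ys x∈ y∈ = ∈-concatMap⁺ (λ x → map (f x) (ys x)) (lose x∈ (∈-map⁺ (f _) y∈))

∈-concatMap-map⁻ : ∀ {C : Set} (f : A → B → C) (ys : A → List B) {xs z} →
                   z ∈ concatMap (λ x → map (f x) (ys x)) xs →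
                   ∃ λ x → x ∈ xs × ∃ λ y → y ∈ ys x × z ≡ f x y
∈-concatMap-map⁻ f ys {xs} z∈
  with x , x∈ , z∈′ ← find (∈-concatMap⁻ (λ x → map (f x) (ys x)) {xs = xs} z∈) =
  x , x∈ , ∈-map⁻ (f x) z∈′

splits-sound : ∀ {n} s (c : Vec ℕ n) {rd} → rd ∈ splits s c → Split s c rd
splits-sound s []      (here ≡.refl) = split [] [] ≡.refl
splits-sound {suc n} s (x ∷ c) rd∈
  with j , j∈ , (r , d) , rd∈′ , ≡.refl ←
    ∈-concatMap-map⁻ (distribute s x) (λ _ → splits (suc s) c) {upTo (suc x)} rd∈
  with split sr rr e ← splits-sound (suc s) c rd∈′ =
  split (Sorted-replicate-++ s j sr (InRange⇒> rr))
        (Allₚ.++⁺ (InRange-replicate s n j) (InRange-suc rr))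
        (≡.trans (≡.cong (λ v → zipWith ℕ._+_ v ((x ∸ j) ∷ d)) (contents-replicate-++ n s j (InRange⇒> rr)))
          (≡.cong₂ _∷_ (ℕₚ.m+[n∸m]≡n (ℕₚ.≤-pred (∈-upTo⁻ j∈))) e))

splits-complete : ∀ {n} s (c : Vec ℕ n) {rd} → Split s c rd → rd ∈ splits s c
splits-complete s [] {[] , []}    (split _ _ _) = here ≡.refl
splits-complete s [] {x ∷ r , []} (split _ ((s≤x , x<s) ∷ _) _) =
  ⊥-elim (ℕₚ.<⇒≱ x<s (≡.subst (_≤ x) (≡.sym (ℕₚ.+-identityʳ s)) s≤x))
splits-complete {suc n} s (x ∷ c) {r , y ∷ d} (split sr rr e)
  with r′ , r≡ , sr′ , s<r′ ← leading-entries s sr (All.map proj₁ rr) =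
  ≡.subst (_∈ splits s (x ∷ c))
    (≡.cong₂ (λ r z → r , z ∷ d) (≡.sym r≡)
      (≡.trans (≡.cong (_∸ j) (≡.sym j+y≡x)) (ℕₚ.m+n∸m≡n j y)))
    (∈-concatMap-map⁺ (distribute s x) (λ _ → splits (suc s) c)
      (∈-upTo⁺ (s≤s (≡.subst (j ≤_) j+y≡x (ℕₚ.m≤m+n j y))))
      (splits-complete (suc s) c (split sr′
        (InRange-pred (Allₚ.++⁻ʳ (replicate j s) (≡.subst (InRange s (suc n)) r≡ rr)) s<r′)
        (≡.trans (≡.cong (λ v → zipWith ℕ._+_ v d) (≡.sym contents-r)) (≡.cong Vec.tail e)))))
  where
  j : ℕ
  j = countVal s r
  j+y≡x : j ℕ.+ y ≡ x
  j+y≡x = ≡.cong Vec.head e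
  contents-r : contents n (suc s) r ≡ contents n (suc s) r′
  contents-r = ≡.trans (≡.cong (contents n (suc s)) r≡) (contents-small n j r′ ℕₚ.≤-refl)

splits-length : ∀ {n} s (c : Vec ℕ n) {rd} → rd ∈ splits s c →
                length (proj₁ rd) ℕ.+ sum (toList (proj₂ rd)) ≡ sum (toList c)
splits-length s []      (here ≡.refl) = ≡.refl
splits-length s (x ∷ c) rd∈
  with j , j∈ , (r , d) , rd∈′ , ≡.refl ←
    ∈-concatMap-map⁻ (distribute s x) (λ _ → splits (suc s) c) {upTo (suc x)} rd∈ = begin
  length (replicate j s ++ r) ℕ.+ (x ∸ j ℕ.+ sum (toList d))
    ≡⟨ ≡.cong (ℕ._+ _) (≡.trans (length-++ (replicate j s)) (≡.cong (ℕ._+ length r) (length-replicate j))) ⟩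
  j ℕ.+ length r ℕ.+ (x ∸ j ℕ.+ sum (toList d))
    ≡⟨ interchange j (length r) (x ∸ j) _ ⟩
  j ℕ.+ (x ∸ j) ℕ.+ (length r ℕ.+ sum (toList d))
    ≡⟨ ≡.cong₂ ℕ._+_ (ℕₚ.m+[n∸m]≡n (ℕₚ.≤-pred (∈-upTo⁻ j∈))) (splits-length (suc s) c rd∈′) ⟩
  x ℕ.+ sum (toList c) ∎
  where
  open ≡.≡-Reasoning
  open import Algebra.Properties.CommutativeSemigroup ℕₚ.+-commutativeSemigroup using (interchange)

splits-unique : ∀ {n} s (c : Vec ℕ n) → Unique (splits s c)
splits-unique s []      = [] ∷ []
-- The number of copies taken is recovered from the number left over.
splits-unique s (x ∷ c) = Unique-concatMap _ (λ rd → x ∸ Vec.head (proj₂ rd)) (Uniqueₚ.upTo⁺ (suc x))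
  (λ {j} _ → Uniqueₚ.map⁺ (λ e → ≡.cong₂ _,_ (++-cancelˡ (replicate j s) _ _ (≡.cong proj₁ e))
                                              (≡.cong (Vec.tail ∘ proj₂) e)) (splits-unique (suc s) c))
  (λ {j} j∈ rd∈ → retract (ℕₚ.≤-pred (∈-upTo⁻ j∈)) (∈-map⁻ _ rd∈))
  where
  retract : ∀ {j rd} → j ≤ x →
    (∃ λ rd′ → rd′ ∈ splits (suc s) c × rd ≡ distribute s x j rd′) →
    x ∸ Vec.head (proj₂ rd) ≡ j
  retract j≤x (_ , _ , ≡.refl) = ℕₚ.m∸[m∸n]≡n j≤x

-- The order conditions compare all pairs rather than neighbours, so the smallest letter is compared
-- with every other entry at once. The alphabet starts at `s` because lower rows use only larger
-- letters.
record Immaculate {n} (s : ℕ) (c : Vec ℕ n) (T : Tableau) : Set where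
  constructor immaculate
  field
    rows-nonempty : All (λ R → nonempty R ≡ true) T
    rows-sorted   : All Sorted T
    column-sorted : AllPairs _<_ (firstColumn T)
    entries-range : InRange s n (concat T)
    entries-count : contents n s (concat T) ≡ c

All-firstColumn : ∀ {P : ℕ → Set} T → All P (concat T) → All P (firstColumn T)
All-firstColumn []            ps       = []
All-firstColumn ([] ∷ T)      ps       = All-firstColumn T ps
All-firstColumn ((x ∷ R) ∷ T) (p ∷ ps) = p ∷ All-firstColumn T (Allₚ.++⁻ʳ R ps)

-- A row is bounded below by its first entry. Applied to the rows below the first, this forces every
-- copy of the smallest letter into the first row.
above-column : ∀ {s T} → All (λ R → nonempty R ≡ true) T → All Sorted T →
               All (s <_) (firstColumn T) → All (s <_) (concat T)
above-column {T = []}          []       []               s<       = []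
above-column {T = (x ∷ R) ∷ T} (_ ∷ ne) ((x≤ ∷ _) ∷ sr) (s<x ∷ s<) =
  s<x ∷ Allₚ.++⁺ (All.map (ℕₚ.<-≤-trans s<x) x≤) (above-column ne sr s<)

tableaux-∷⁻ : ∀ {n} s b (c : Vec ℕ n) {T} → T ∈ tableaux s (suc b ∷ c) →
  ∃ λ rd → rd ∈ splits (suc s) c × ∃ λ T′ → T′ ∈ tableaux (suc s) (proj₂ rd) ×
  T ≡ (replicate (suc b) s ++ proj₁ rd) ∷ T′
tableaux-∷⁻ {n} s b c = ∈-concatMap-map⁻ {A = List ℕ × Vec ℕ n}
  (λ rd → (replicate (suc b) s ++ proj₁ rd) ∷_) (λ rd → tableaux (suc s) (proj₂ rd))

tableaux-sound : ∀ {n} s (c : Vec ℕ n) {T} → T ∈ tableaux s c → Immaculate s c T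
tableaux-sound s []          (here ≡.refl) = immaculate [] [] [] [] ≡.refl
tableaux-sound s (zero ∷ c)  T∈ with immaculate ne sr col rg ct ← tableaux-sound (suc s) c T∈ =
  immaculate ne sr col (InRange-suc rg) (≡.cong₂ _∷_ (>⇒absent (InRange⇒> rg)) ct)
tableaux-sound {suc n} s (suc b ∷ c) T∈
  with (r , d) , rd∈ , T , T∈′ , ≡.refl ← tableaux-∷⁻ s b c T∈
  with split srow rrow crow ← splits-sound (suc s) c rd∈
  with immaculate ne sr col rg ct ← tableaux-sound (suc s) d T∈′ =
  immaculate (≡.refl ∷ ne)
    (Sorted-replicate-++ s (suc b) srow (InRange⇒> rrow) ∷ sr)
    (All-firstColumn T (InRange⇒> rg) ∷ col)
    (Allₚ.++⁺ (Allₚ.++⁺ (InRange-replicate s n (suc b)) (InRange-suc rrow)) (InRange-suc rg))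
    (≡.trans (contents-++ (suc n) s (replicate (suc b) s ++ r) (concat T))
      (≡.trans (≡.cong₂ (zipWith ℕ._+_) (contents-replicate-++ n s (suc b) (InRange⇒> rrow))
                                       (≡.cong₂ _∷_ (>⇒absent (InRange⇒> rg)) ct))
        (≡.cong₂ _∷_ (ℕₚ.+-identityʳ (suc b)) crow)))

-- By `above-column` all copies of s lie in the first row, so `leading-entries` finds exactly
-- `suc b` of them in front. The remainder of the split is taken to be the content of the lower
-- rows, and the equation required of a split becomes additivity of content.
tableaux-complete : ∀ {n} s (c : Vec ℕ n) {T} → Immaculate s c T → T ∈ tableaux s c
tableaux-complete s [] {[]}          _ = here ≡.refl
tableaux-complete s [] {[] ∷ T}      (immaculate (() ∷ _) _ _ _ _)
tableaux-complete s [] {(x ∷ R) ∷ T} (immaculate _ _ _ ((s≤x , x<s) ∷ _) _) =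
  ⊥-elim (ℕₚ.<⇒≱ x<s (≡.subst (_≤ x) (≡.sym (ℕₚ.+-identityʳ s)) s≤x))
tableaux-complete s (zero ∷ c) {T} (immaculate ne sr col rg ct) =
  tableaux-complete (suc s) c (immaculate ne sr col
    (InRange-pred rg (All.zipWith (λ ((s≤x , _) , x≢s) → ℕₚ.≤∧≢⇒< s≤x (x≢s ∘ ≡.sym))
                                  (rg , absent (concat T) (≡.cong Vec.head ct))))
    (≡.cong Vec.tail ct))
tableaux-complete s (suc b ∷ c) {[]}     (immaculate _ _ _ _ ())
tableaux-complete s (suc b ∷ c) {[] ∷ T} (immaculate (() ∷ _) _ _ _ _)
tableaux-complete {suc n} s (suc b ∷ c) {(x ∷ R) ∷ T} (immaculate (_ ∷ ne) (sR ∷ sr) (x< ∷ col) rg ct)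
  with r , R≡ , srow , s<r ← leading-entries s sR (All.map proj₁ (Allₚ.++⁻ˡ (x ∷ R) rg)) =
  ≡.subst (_∈ tableaux s (suc b ∷ c)) (≡.cong (_∷ T) (≡.sym R≡′))
    (∈-concatMap-map⁺ {A = List ℕ × Vec ℕ n} (λ rd → (replicate (suc b) s ++ proj₁ rd) ∷_)
      (λ rd → tableaux (suc s) (proj₂ rd))
      (splits-complete (suc s) c {r , d} (split srow
        (InRange-pred (Allₚ.++⁻ʳ (replicate (suc b) s)
          (≡.subst (InRange s (suc n)) R≡′ (Allₚ.++⁻ˡ (x ∷ R) rg))) s<r)
        (≡.trans (≡.cong (λ v → zipWith ℕ._+_ v d) (≡.sym contents-R))
          (≡.trans (≡.sym (contents-++ n (suc s) (x ∷ R) (concat T))) (≡.cong Vec.tail ct)))))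
      (tableaux-complete (suc s) d (immaculate ne sr col
        (InRange-pred (Allₚ.++⁻ʳ (x ∷ R) rg) s<T) ≡.refl)))
  where
  d : Vec ℕ n
  d = contents n (suc s) (concat T)
  s<T : All (s <_) (concat T)
  s<T = above-column ne sr (All.map (ℕₚ.≤-<-trans (proj₁ (All.head rg))) x<)
  count-R : countVal s (x ∷ R) ≡ suc b
  count-R = ≡.trans (≡.sym (ℕₚ.+-identityʳ _)) (≡.trans
    (≡.cong (countVal s (x ∷ R) ℕ.+_) (≡.sym (>⇒absent s<T)))
    (≡.trans (≡.sym (countVal-++ s (x ∷ R) (concat T))) (≡.cong Vec.head ct)))
  R≡′ : x ∷ R ≡ replicate (suc b) s ++ r
  R≡′ = ≡.trans R≡ (≡.cong (λ k → replicate k s ++ r) count-R)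
  contents-R : contents n (suc s) (x ∷ R) ≡ contents n (suc s) r
  contents-R = ≡.trans (≡.cong (contents n (suc s)) R≡′) (contents-small n (suc b) r ℕₚ.≤-refl)

tableaux-length : ∀ {n} s (c : Vec ℕ n) {T} → T ∈ tableaux s c → length (concat T) ≡ sum (toList c)
tableaux-length s []          (here ≡.refl) = ≡.refl
tableaux-length s (zero ∷ c)  T∈ = tableaux-length (suc s) c T∈
tableaux-length s (suc b ∷ c) T∈
  with (r , d) , rd∈ , T , T∈′ , ≡.refl ← tableaux-∷⁻ s b c T∈ = begin
  length ((replicate (suc b) s ++ r) ++ concat T)
    ≡⟨ ≡.trans (≡.cong length (++-assoc (replicate (suc b) s) r (concat T)))
         (≡.trans (length-++ (replicate (suc b) s)) (≡.cong₂ ℕ._+_ (length-replicate (suc b)) (length-++ r))) ⟩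
  suc b ℕ.+ (length r ℕ.+ length (concat T))
    ≡⟨ ≡.cong (λ k → suc b ℕ.+ (length r ℕ.+ k)) (tableaux-length (suc s) d T∈′) ⟩
  suc b ℕ.+ (length r ℕ.+ sum (toList d))
    ≡⟨ ≡.cong (suc b ℕ.+_) (splits-length (suc s) c rd∈) ⟩
  suc b ℕ.+ sum (toList c) ∎
  where open ≡.≡-Reasoning

drop-replicate-++ : ∀ {x : A} j ys → drop j (replicate j x ++ ys) ≡ ys
drop-replicate-++ zero    ys = ≡.refl
drop-replicate-++ (suc j) ys = drop-replicate-++ j ys

tableaux-unique : ∀ {n} s (c : Vec ℕ n) → Unique (tableaux s c)
tableaux-unique s []          = [] ∷ []
tableaux-unique s (zero ∷ c)  = tableaux-unique (suc s) c
tableaux-unique {suc n} s (suc b ∷ c) = Unique-concatMap _ first-split (splits-unique (suc s) c)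
  (λ {rd} _ → Uniqueₚ.map⁺ ∷-injectiveʳ (tableaux-unique (suc s) (proj₂ rd)))
  (λ {rd} _ T∈ → retract (∈-map⁻ _ T∈))
  where
  first-split : Tableau → List ℕ × Vec ℕ n
  -- A default value; each tableau of the list has a first row.
  first-split []      = [] , contents n (suc s) []
  first-split (R ∷ T) = drop (suc b) R , contents n (suc s) (concat T)
  retract : ∀ {r d T} → (∃ λ T′ → T′ ∈ tableaux (suc s) d × T ≡ (replicate (suc b) s ++ r) ∷ T′) →
            first-split T ≡ (r , d)
  retract {r} {d} (T′ , T′∈ , ≡.refl) = ≡.cong₂ _,_ (drop-replicate-++ (suc b) r)
    (Immaculate.entries-count (tableaux-sound (suc s) d T′∈))

-- Comparison of the filtered candidates with the recursive enumeration

∧-true⁻ : ∀ {a b} → a ∧ b ≡ true → a ≡ true × b ≡ true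
∧-true⁻ {true} {true} _ = ≡.refl , ≡.refl

∧-true⁺ : ∀ {a b} → a ≡ true → b ≡ true → a ∧ b ≡ true
∧-true⁺ ≡.refl ≡.refl = ≡.refl

≤ᵇ-true⁻ : ∀ {m n} → (m ≤ᵇ n) ≡ true → m ≤ n
≤ᵇ-true⁻ {m} {n} e = ℕₚ.≤ᵇ⇒≤ m n (Equivalence.from T-≡ e)

≤ᵇ-true⁺ : ∀ {m n} → m ≤ n → (m ≤ᵇ n) ≡ true
≤ᵇ-true⁺ m≤n = Equivalence.to T-≡ (ℕₚ.≤⇒≤ᵇ m≤n)

<ᵇ-true⁻ : ∀ {m n} → (m <ᵇ n) ≡ true → m < n
<ᵇ-true⁻ {m} {n} e = ℕₚ.<ᵇ⇒< m n (Equivalence.from T-≡ e)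

<ᵇ-true⁺ : ∀ {m n} → m < n → (m <ᵇ n) ≡ true
<ᵇ-true⁺ m<n = Equivalence.to T-≡ (ℕₚ.<⇒<ᵇ m<n)

==-true⁻ : ∀ u v → (u == v) ≡ true → u ≡ v
==-true⁻ u v e with ≡-dec ℕ._≟_ u v
... | yes u≡v = u≡v

==-true⁺ : ∀ u v → u ≡ v → (u == v) ≡ true
==-true⁺ u v u≡v with ≡-dec ℕ._≟_ u v
... | yes _  = ≡.refl
... | no u≢v = ⊥-elim (u≢v u≡v)

allᵇ-true⁻ : ∀ {p : A → Bool} xs → allᵇ p xs ≡ true → All (λ x → p x ≡ true) xs
allᵇ-true⁻ []       _ = []
allᵇ-true⁻ (x ∷ xs) e with px , pxs ← ∧-true⁻ e = px ∷ allᵇ-true⁻ xs pxs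

allᵇ-true⁺ : ∀ {p : A → Bool} {xs} → All (λ x → p x ≡ true) xs → allᵇ p xs ≡ true
allᵇ-true⁺ []         = ≡.refl
allᵇ-true⁺ (px ∷ pxs) = ∧-true⁺ px (allᵇ-true⁺ pxs)

weaklyInc⁻ : ∀ w → weaklyInc w ≡ true → Sorted w
weaklyInc⁻ w e = Linkedₚ.Linked⇒AllPairs ℕₚ.≤-trans (linked w e)
  where
  linked : ∀ w → weaklyInc w ≡ true → Linked _≤_ w
  linked []          _ = []
  linked (x ∷ [])    _ = [-]
  linked (x ∷ y ∷ w) e = ≤ᵇ-true⁻ (proj₁ (∧-true⁻ e)) ∷ linked (y ∷ w) (proj₂ (∧-true⁻ {x ≤ᵇ y} e))

weaklyInc⁺ : ∀ {w} → Sorted w → weaklyInc w ≡ true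
weaklyInc⁺ []                          = ≡.refl
weaklyInc⁺ (_ ∷ [])                    = ≡.refl
weaklyInc⁺ ((x≤y ∷ _) ∷ sw@(_ ∷ _))    = ∧-true⁺ (≤ᵇ-true⁺ x≤y) (weaklyInc⁺ sw)

strictlyInc⁻ : ∀ w → strictlyInc w ≡ true → AllPairs _<_ w
strictlyInc⁻ w e = Linkedₚ.Linked⇒AllPairs ℕₚ.<-trans (linked w e)
  where
  linked : ∀ w → strictlyInc w ≡ true → Linked _<_ w
  linked []          _ = []
  linked (x ∷ [])    _ = [-]
  linked (x ∷ y ∷ w) e = <ᵇ-true⁻ (proj₁ (∧-true⁻ e)) ∷ linked (y ∷ w) (proj₂ (∧-true⁻ {x <ᵇ y} e))

strictlyInc⁺ : ∀ {w} → AllPairs _<_ w → strictlyInc w ≡ true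
strictlyInc⁺ []                          = ≡.refl
strictlyInc⁺ (_ ∷ [])                    = ≡.refl
strictlyInc⁺ ((x<y ∷ _) ∷ sw@(_ ∷ _))    = ∧-true⁺ (<ᵇ-true⁺ x<y) (strictlyInc⁺ sw)

toList-contents : ∀ n s w → toList (contents n s w) ≡ applyUpTo (λ i → countVal (s ℕ.+ i) w) n
toList-contents zero    s w = ≡.refl
toList-contents (suc n) s w = ≡.cong₂ _∷_ (≡.cong (λ i → countVal i w) (≡.sym (ℕₚ.+-identityʳ s)))
  (≡.trans (toList-contents n (suc s) w) 
    (applyUpTo-cong (λ i → ≡.cong (λ k → countVal k w) (≡.sym (ℕₚ.+-suc s i))) n))
  where
  applyUpTo-cong : ∀ {f g : ℕ → ℕ} → (∀ i → f i ≡ g i) → ∀ n → applyUpTo f n ≡ applyUpTo g n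
  applyUpTo-cong e zero    = ≡.refl
  applyUpTo-cong e (suc n) = ≡.cong₂ _∷_ (e 0) (applyUpTo-cong (e ∘ suc) n)

countVals : ∀ (β : Comp) w → map (λ i → countVal (suc i) w) (upTo (length β)) ≡ toList (contents (length β) 1 w)
countVals β w = ≡.trans (map-upTo _ (length β)) (≡.sym (toList-contents (length β) 1 w))

toList-injective : ∀ {n} (u v : Vec ℕ n) → toList u ≡ toList v → u ≡ v
toList-injective []      []      _ = ≡.refl
toList-injective (x ∷ u) (y ∷ v) e = ≡.cong₂ _∷_ (∷-injectiveˡ e) (toList-injective u v (∷-injectiveʳ e))

isImmaculate⁻ : ∀ β T → isImmaculate β T ≡ true → Immaculate 1 (fromList β) T
isImmaculate⁻ β T e
  with ne , e₁ ← ∧-true⁻ {allᵇ nonempty T} e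
  with wi , e₂ ← ∧-true⁻ {allᵇ weaklyInc T} e₁
  with si , e₃ ← ∧-true⁻ {strictlyInc (firstColumn T)} e₂
  with rg , ct ← ∧-true⁻ e₃ = immaculate
  (allᵇ-true⁻ T ne)
  (All.map (λ {w} → weaklyInc⁻ w) (allᵇ-true⁻ T wi))
  (strictlyInc⁻ (firstColumn T) si)
  (All.map (λ e → ≤ᵇ-true⁻ (proj₁ (∧-true⁻ e)) , s≤s (≤ᵇ-true⁻ (proj₂ (∧-true⁻ e))))
           (allᵇ-true⁻ (concat T) rg))
  (toList-injective (contents (length β) 1 (concat T)) (fromList β) (≡.trans (≡.sym (countVals β (concat T)))
    (≡.trans (==-true⁻ (map (λ i → countVal (suc i) (concat T)) (upTo (length β))) β ct)
      (≡.sym (Vecₚ.toList∘fromList β)))))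

isImmaculate⁺ : ∀ β {T} → Immaculate 1 (fromList β) T → isImmaculate β T ≡ true
isImmaculate⁺ β {T} (immaculate ne sr col rg ct) =
  ∧-true⁺ (allᵇ-true⁺ ne) (∧-true⁺ (allᵇ-true⁺ (All.map weaklyInc⁺ sr)) (∧-true⁺ (strictlyInc⁺ col)
    (∧-true⁺ (allᵇ-true⁺ (All.map (λ (1≤x , x<) → ∧-true⁺ (≤ᵇ-true⁺ 1≤x) (≤ᵇ-true⁺ (ℕₚ.≤-pred x<))) rg))
             (==-true⁺ (map (λ i → countVal (suc i) (concat T)) (upTo (length β))) β
               (≡.trans (countVals β (concat T))
                          (≡.trans (≡.cong toList ct) (Vecₚ.toList∘fromList β)))))))

words-length : ∀ n k {w} → w ∈ words n k → length w ≡ n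
words-length zero    k (here ≡.refl) = ≡.refl
words-length (suc n) k w∈
  with x , _ , w , w∈′ , ≡.refl ← ∈-concatMap-map⁻ _∷_ (λ _ → words n k) {map suc (upTo k)} w∈ =
  ≡.cong suc (words-length n k w∈′)

words-complete : ∀ {n} k {w} → length w ≡ n → InRange 1 k w → w ∈ words n k
words-complete k {[]}        ≡.refl [] = here ≡.refl
words-complete k {suc x ∷ w} ≡.refl ((_ , s≤s x<k) ∷ rg) =
  ∈-concatMap-map⁺ _∷_ (λ _ → words (length w) k) (∈-map⁺ suc (∈-upTo⁺ x<k)) (words-complete k ≡.refl rg)

words-unique : ∀ n k → Unique (words n k)
words-unique zero    k = [] ∷ []
words-unique (suc n) k = Unique-concatMap _ head (Uniqueₚ.map⁺ ℕₚ.suc-injective (Uniqueₚ.upTo⁺ k))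
  (λ _ → Uniqueₚ.map⁺ ∷-injectiveʳ (words-unique n k)) (λ _ w∈ → retract (∈-map⁻ _ w∈))
  where
  head : List ℕ → ℕ
  head []      = 0
  head (x ∷ _) = x
  retract : ∀ {x w} → (∃ λ w′ → w′ ∈ words n k × w ≡ x ∷ w′) → head w ≡ x
  retract (_ , _ , ≡.refl) = ≡.refl

shape-cut : ∀ α w → length w ≡ sum α → shape (cut α w) ≡ α
shape-cut []      w e = ≡.refl
shape-cut (a ∷ α) w e = ≡.cong₂ _∷_
  (≡.trans (length-take a w) (ℕₚ.m≤n⇒m⊓n≡m (≡.subst (a ≤_) (≡.sym e) (ℕₚ.m≤m+n a (sum α)))))
  (shape-cut α (drop a w) (≡.trans (length-drop a w) (≡.trans (≡.cong (_∸ a) e) (ℕₚ.m+n∸m≡n a (sum α)))))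

concat-cut : ∀ α w → length w ≡ sum α → concat (cut α w) ≡ w
concat-cut []      []      e = ≡.refl
concat-cut (a ∷ α) w       e = ≡.trans
  (≡.cong (take a w ++_) (concat-cut α (drop a w)
    (≡.trans (length-drop a w) (≡.trans (≡.cong (_∸ a) e) (ℕₚ.m+n∸m≡n a (sum α))))))
  (take++drop≡id a w)

cut-shape : ∀ T → cut (shape T) (concat T) ≡ T
cut-shape []      = ≡.refl
cut-shape (R ∷ T) = ≡.cong₂ _∷_ (take-++ R) (≡.trans (≡.cong (cut (shape T)) (drop-++ R)) (cut-shape T))
  where
  take-++ : ∀ (R : List ℕ) {w} → take (length R) (R ++ w) ≡ R
  take-++ []      = ≡.refl
  take-++ (x ∷ R) = ≡.cong (x ∷_) (take-++ R)
  drop-++ : ∀ (R : List ℕ) {w} → drop (length R) (R ++ w) ≡ w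
  drop-++ []      = ≡.refl
  drop-++ (x ∷ R) = drop-++ R

-- A filling determines its shape by `shape` and its reading word by `concat`; both recover their
-- data because the words have length |α|.
candidates-unique : ∀ β → Unique (candidates β)
candidates-unique β = Unique-concatMap _ shape (comps-unique (sum β))
  (λ {α} α∈ → Unique-map (cut α) concat (words-unique (sum β) (length β))
     (λ w∈ → concat-cut α _ (fits α∈ w∈)))
  (λ α∈ T∈ → retract α∈ (∈-map⁻ _ T∈))
  where
  fits : ∀ {α w} → α ∈ comps (sum β) → w ∈ words (sum β) (length β) → length w ≡ sum α
  fits α∈ w∈ = ≡.trans (words-length (sum β) (length β) w∈) (≡.sym (All.lookup (comps-sum (sum β)) α∈))
  retract : ∀ {α T} → α ∈ comps (sum β) → (∃ λ w → w ∈ words (sum β) (length β) × T ≡ cut α w) → shape T ≡ α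
  retract {α} α∈ (w , w∈ , ≡.refl) = shape-cut α w (fits α∈ w∈)

length-concat : ∀ (T : Tableau) → length (concat T) ≡ sum (shape T)
length-concat []      = ≡.refl
length-concat (R ∷ T) = ≡.trans (length-++ R) (≡.cong (length R ℕ.+_) (length-concat T))

tableaux⊆candidates : ∀ β {T} → T ∈ tableaux 1 (fromList β) → T ∈ candidates β
tableaux⊆candidates β {T} T∈ with immaculate ne _ _ rg _ ← tableaux-sound 1 (fromList β) T∈ =
  ≡.subst (_∈ candidates β) (cut-shape T)
    (∈-concatMap-map⁺ cut (λ _ → words (sum β) (length β))
      (comps-complete (sum β) (Allₚ.map⁺ (All.map (λ {R} → nonempty⇒ R) ne))
        (≡.trans (≡.sym (length-concat T)) size-T))
      (words-complete (length β) size-T rg))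
  where
  nonempty⇒ : ∀ R → nonempty R ≡ true → 1 ≤ length R
  nonempty⇒ (x ∷ R) _ = s≤s z≤n
  size-T : length (concat T) ≡ sum β
  size-T = ≡.trans (tableaux-length 1 (fromList β) T∈) (≡.cong sum (Vecₚ.toList∘fromList β))

-- Two lists without repetitions and with the same members are permutations of each other; no
-- comparison of their orders enters.
immaculateTableaux-↭ : ∀ β → immaculateTableaux β ↭ tableaux 1 (fromList β)
immaculateTableaux-↭ β = ∼bag⇒↭ (unique∧set⇒bag
  (Uniqueₚ.filter⁺ imm? (candidates-unique β)) (tableaux-unique 1 (fromList β))
  (mk⇔ (λ T∈ → tableaux-complete 1 (fromList β)
                  (isImmaculate⁻ β _ (proj₂ (∈-filter⁻ imm? {xs = candidates β} T∈))))
       (λ T∈ → ∈-filter⁺ imm? (tableaux⊆candidates β T∈)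
                  (isImmaculate⁺ β (tableaux-sound 1 (fromList β) T∈)))))
  where
  imm? : ∀ T → Dec (isImmaculate β T ≡ true)
  imm? T = Data.Bool._≟_ (isImmaculate β T) true

deduplicate-replicate : ∀ s j {r} → All (s <_) r →
  deduplicate ℕ._≟_ (replicate (suc j) s ++ r) ≡ s ∷ deduplicate ℕ._≟_ r
deduplicate-replicate s zero    {r} s<r = ≡.cong (s ∷_)
  (filter-all (¬? ∘ (s ℕ.≟_)) (All.map ℕₚ.<⇒≢ (Allₚ.deduplicate⁺ ℕ._≟_ s<r)))
deduplicate-replicate s (suc j) {r} s<r = ≡.cong (s ∷_) (≡.trans
  (≡.cong (filter (¬? ∘ (s ℕ.≟_))) (deduplicate-replicate s j s<r))
  (≡.trans (filter-reject (¬? ∘ (s ℕ.≟_)) {xs = deduplicate ℕ._≟_ r} (λ s≢s → s≢s ≡.refl))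
           (filter-all (¬? ∘ (s ℕ.≟_)) (All.map ℕₚ.<⇒≢ (Allₚ.deduplicate⁺ ℕ._≟_ s<r)))))

-- The operators 𝔹 and 𝔹̃

open CommutativeRing polyRing using (_≈_; _+_; _*_; 0#; 1#; *-cong; *-congˡ; *-congʳ; *-assoc;
  *-identityˡ; *-identityʳ; zeroˡ; zeroʳ; distribʳ; +-cong; +-congʳ; +-identityˡ; +-identityʳ; setoid)
  renaming (refl to ≈-refl; sym to ≈-sym; trans to ≈-trans; reflexive to ≈-reflexive)
open FiniteSums polyRing
open Skewing polyRing
open RemovalSums polyRing
open SetoidReasoning setoid

q : Poly
q = + 0 ∷ + 1 ∷ []

qpow≈qPow : ∀ i → qpow i ≈ qPow q i
qpow≈qPow zero    = ≈-refl
qpow≈qPow (suc i) = ≈-trans (coefwise coefs-qpow) (*-congˡ {q} (qpow≈qPow i))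
  where
  coefs-qpow : qpow (suc i) ≈P mulP q (qpow i)
  coefs-qpow k = ≡.sym (≡.trans (coefP-addP (scalP (+ 0) (qpow i)) (+ 0 ∷ mulP oneP (qpow i)) k)
    (≡.trans (≡.cong₂ ℤ._+_ (≡.trans (coefP-scalP (+ 0) (qpow i) k) (ℤₚ.*-zeroˡ (coefP (qpow i) k)))
                            (tail k))
             (ℤₚ.+-identityˡ _)))
    where
    tail : ∀ k → coefP (+ 0 ∷ mulP oneP (qpow i)) k ≡ coefP (qpow (suc i)) k
    tail zero    = ≡.refl
    tail (suc k) = mulP-identityˡ (qpow i) k

signP≡sign : ∀ i → signP i ≡ sign i
signP≡sign zero    = ≡.refl
signP≡sign (suc i) = ≡.cong negP (signP≡sign i)

-- The linear extension of a function on words.  Since NSym elements are unreduced formal sums,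
-- operators are compared through all functionals φ.
ev : (Comp → Poly) → NSym → Poly
ev φ f = ∑∈ f (λ t → proj₁ t * φ (proj₂ t))

ev-concat : ∀ φ fs → ev φ (sumN fs) ≈ ∑∈ fs (ev φ)
ev-concat φ fs = ∑∈-concat _ fs

ev-scaleN : ∀ φ p f → ev φ (scaleN p f) ≈ p * ev φ f
ev-scaleN φ p f = ≈-trans (∑∈-map _ _ f)
  (≈-trans (∑∈-cong f (λ t → *-assoc p (proj₁ t) (φ (proj₂ t)))) (≈-sym (∑∈-distribˡ p _ f)))

ev-Hmul : ∀ φ m f → ev φ (Hmul m f) ≈ ev (φ ∘ consH m) f
ev-Hmul φ m f = ∑∈-map _ _ f

ev-cong : ∀ {φ ψ} f → (∀ w → φ w ≈ ψ w) → ev φ f ≈ ev ψ f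
ev-cong f e = ∑∈-cong f (λ t → *-congˡ {proj₁ t} (e (proj₂ t)))

-- The duality between `perpM` and `removals` runs over `comps`, hence over words with positive
-- parts. The operators produce only such words.
Pos : NSym → Set
Pos = All (Positive ∘ proj₂)

constP-0 : constP (+ 0) ≈ 0#
constP-0 = coefwise λ { zero → ≡.refl ; (suc k) → ≡.refl }

∑-single : ∀ (φ : Comp → Poly) {us u} → Unique us → u ∈ us →
           ∑∈ us (λ v → constP (+ countIn v (u ∷ [])) * φ v) ≈ φ u
∑-single φ {u ∷ vs} (v∉ ∷ uvs) (here ≡.refl) = begin
  constP (+ countIn u (u ∷ [])) * φ u + ∑∈ vs (λ v → constP (+ countIn v (u ∷ [])) * φ v)
    ≈⟨ +-cong (*-congʳ (≈-reflexive (≡.cong (constP ∘ +_) (countIn-≡ {u} [] ≡.refl))))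
              (≈-trans (∑∈-cong-All (All.map vanish v∉)) (∑∈-zero vs)) ⟩
  1# * φ u + 0#
    ≈⟨ ≈-trans (+-identityʳ _) (*-identityˡ (φ u)) ⟩
  φ u ∎
  where
  vanish : ∀ {v} → u ≢ v → constP (+ countIn v (u ∷ [])) * φ v ≈ 0#
  vanish {v} u≢v = ≈-trans (*-congʳ (≈-trans
    (≈-reflexive (≡.cong (constP ∘ +_) (countIn-≢ [] (u≢v ∘ ≡.sym)))) constP-0)) (zeroˡ (φ v))
∑-single φ {v ∷ vs} {u} (v∉ ∷ uvs) (there u∈) = begin
  constP (+ countIn v (u ∷ [])) * φ v + ∑∈ vs (λ v → constP (+ countIn v (u ∷ [])) * φ v)
    ≈⟨ +-cong (≈-trans (*-congʳ (≈-trans (≈-reflexive (≡.cong (constP ∘ +_)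
                (countIn-≢ [] (All.lookup v∉ u∈)))) constP-0)) (zeroˡ (φ v)))
              (∑-single φ uvs u∈) ⟩
  0# + φ u ≈⟨ +-identityˡ _ ⟩
  φ u ∎

-- Turns a sum over all compositions weighted by multiplicity into a sum over the list `vs` itself,
-- since each entry of `vs` meets exactly one index in `us`.
∑-countIn : ∀ (φ : Comp → Poly) {us} → Unique us → ∀ {vs} → All (_∈ us) vs →
            ∑∈ us (λ u → constP (+ countIn u vs) * φ u) ≈ ∑∈ vs φ
∑-countIn φ {us} uus {[]} [] =
  ≈-trans (∑∈-cong us (λ u → ≈-trans (*-congʳ constP-0) (zeroˡ (φ u)))) (∑∈-zero us)
∑-countIn φ {us} uus {v ∷ vs} (v∈ ∷ vs⊆) = begin
  ∑∈ us (λ u → constP (+ countIn u (v ∷ vs)) * φ u)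
    ≈⟨ ∑∈-cong us (λ u → ≈-trans (*-congʳ (≈-reflexive
         (≡.cong (constP ∘ +_) (countIn-++ u (v ∷ []) vs))))
         (distribʳ (φ u) (constP (+ countIn u (v ∷ []))) (constP (+ countIn u vs)))) ⟩
  ∑∈ us (λ u → constP (+ countIn u (v ∷ [])) * φ u + constP (+ countIn u vs) * φ u)
    ≈⟨ ∑∈-+ (λ u → constP (+ countIn u (v ∷ [])) * φ u) _ us ⟩
  ∑∈ us (λ u → constP (+ countIn u (v ∷ [])) * φ u) + ∑∈ us (λ u → constP (+ countIn u vs) * φ u)
    ≈⟨ +-cong (∑-single φ uus v∈) (∑-countIn φ uus vs⊆) ⟩
  φ v + ∑∈ vs φ ∎

-- The contribution of one term in `perpM`, named so that the recursion there can be split off.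
perpTerm : Comp → Poly × Comp → NSym
perpTerm γ (c , w) = if size γ ≤ᵇ size w
  then map (λ δ → mulP c (constP (+ countIn w (qsh γ δ))) , δ) (comps (size w ∸ size γ)) else []

-- `perpM` searches all δ for those whose quasi-shuffle with γ contains w. By `countIn-qsh` that
-- multiplicity is the one of δ among the removals, so the search collapses to them; when γ is too
-- large both sides vanish.
ev-perpTerm : ∀ φ γ c {w} → Positive w →
              ev φ (perpTerm γ (c , w)) ≈ c * ∑∈ (removals γ w) φ
ev-perpTerm φ γ c {w} pw with sum γ ℕₚ.≤? sum w
... | no  γ≰w rewrite if-> {s = map (λ δ → mulP c (constP (+ countIn w (qsh γ δ))) , δ)
                                    (comps (size w ∸ size γ))} {t = []} (ℕₚ.≰⇒> γ≰w) =
  ≈-sym (≈-trans (*-congˡ {c} (∑-removals-too-large γ w φ (ℕₚ.≰⇒> γ≰w))) (zeroʳ c))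
... | yes γ≤w rewrite if-≤ {s = map (λ δ → mulP c (constP (+ countIn w (qsh γ δ))) , δ)
                                    (comps (size w ∸ size γ))} {t = []} γ≤w = begin
  ∑∈ (map (λ δ → (c * constP (+ countIn w (qsh γ δ))) , δ) us) (λ t → proj₁ t * φ (proj₂ t))
    ≈⟨ ∑∈-map _ _ us ⟩
  ∑∈ us (λ δ → c * constP (+ countIn w (qsh γ δ)) * φ δ)
    ≈⟨ ∑∈-cong-All (All.map dual (comps-positive (sum w ∸ sum γ))) ⟩
  ∑∈ us (λ δ → c * (constP (+ countIn δ (removals γ w)) * φ δ))
    ≈⟨ ∑∈-distribˡ c _ us ⟨
  c * ∑∈ us (λ δ → constP (+ countIn δ (removals γ w)) * φ δ)
    ≈⟨ *-congˡ {c} (∑-countIn φ (comps-unique (sum w ∸ sum γ)) removals⊆comps) ⟩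
  c * ∑∈ (removals γ w) φ ∎
  where
  us = comps (sum w ∸ sum γ)
  dual : ∀ {δ} → Positive δ →
         c * constP (+ countIn w (qsh γ δ)) * φ δ ≈ c * (constP (+ countIn δ (removals γ w)) * φ δ)
  dual {δ} pδ = ≈-trans (*-assoc c (constP (+ countIn w (qsh γ δ))) (φ δ))
    (*-congˡ {c} (*-congʳ {φ δ} (≈-reflexive (≡.cong (constP ∘ +_) (countIn-qsh γ pδ w)))))
  removals⊆comps : All (_∈ us) (removals γ w)
  removals⊆comps = All.zipWith
    (λ {u} (pu , e) → comps-complete _ pu (≡.trans (≡.sym (ℕₚ.m+n∸m≡n (sum γ) (sum u)))
                                            (≡.cong (_∸ sum γ) e)))
    (removals-positive γ pw , removals-sum γ w)

ev-perpM : ∀ φ γ {f} → Pos f → ev φ (perpM γ f) ≈ ev (λ w → ∑∈ (removals γ w) φ) f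
ev-perpM φ γ []                  = ≈-refl
ev-perpM φ γ {(c , w) ∷ f} (pw ∷ pf) =
  ≈-trans (∑∈-++ _ (perpTerm γ (c , w)) (perpM γ f)) (+-cong (ev-perpTerm φ γ c pw) (ev-perpM φ γ pf))

ev-perpF : ∀ φ i {f} → Pos f → ev φ (perpF i f) ≈ ev (λ w → F⊥ i w φ) f
ev-perpF φ i {f} pf = begin
  ev φ (perpF i f)
    ≈⟨ ≈-trans (ev-concat φ (map (λ γ → perpM γ f) (comps i))) (∑∈-map (ev φ) _ (comps i)) ⟩
  ∑∈ (comps i) (λ γ → ev φ (perpM γ f))
    ≈⟨ ∑∈-cong (comps i) (λ γ → ev-perpM φ γ pf) ⟩
  ∑∈ (comps i) (λ γ → ev (λ w → ∑∈ (removals γ w) φ) f)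
    ≈⟨ ∑∈-comm (λ γ t → proj₁ t * ∑∈ (removals γ (proj₂ t)) φ) (comps i) f ⟩
  ∑∈ f (λ t → ∑∈ (comps i) (λ γ → proj₁ t * ∑∈ (removals γ (proj₂ t)) φ))
    ≈⟨ ∑∈-cong f (λ t → ∑∈-distribˡ (proj₁ t) _ (comps i)) ⟨
  ev (λ w → F⊥ i w φ) f ∎

perpM-Pos : ∀ γ f → Pos (perpM γ f)
perpM-Pos γ []            = []
perpM-Pos γ ((c , w) ∷ f) = Allₚ.++⁺ term (perpM-Pos γ f)
  where
  term : Pos (perpTerm γ (c , w))
  term with size γ ≤ᵇ size w
  ... | true  = Allₚ.map⁺ (comps-positive (size w ∸ size γ))
  ... | false = []

Pos-sumN : ∀ (g : A → NSym) → (∀ x → Pos (g x)) → ∀ xs → Pos (sumN (map g xs))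
Pos-sumN g pg xs = Allₚ.concat⁺ (Allₚ.map⁺ (All.universal pg xs))

perpF-Pos : ∀ i f → Pos (perpF i f)
perpF-Pos i f = Pos-sumN _ (λ γ → perpM-Pos γ f) (comps i)

BB-Pos : ∀ m f → Pos (BB m f)
BB-Pos m f = Pos-sumN _ (λ i → Allₚ.map⁺ (Allₚ.map⁺
  (All.map (consH-positive (m ℕ.+ i)) (perpM-Pos (replicate i 1) f)))) (upTo (suc (degN f)))

BBt-Pos : ∀ m f → Pos (BBt m f)
BBt-Pos m f = Pos-sumN _ (λ i → Allₚ.map⁺ (BB-Pos (m ℕ.+ i) (perpF i f))) (upTo (suc (degN f)))

Q'-Pos : ∀ α → Pos (Q' α)
Q'-Pos []      = [] ∷ []
Q'-Pos (m ∷ α) = BBt-Pos m (Q' α)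

size≤degN : ∀ f → All (λ t → size (proj₂ t) ≤ degN f) f
size≤degN []      = []
size≤degN (t ∷ f) = ℕₚ.m≤m⊔n _ _ ∷ All.map (λ ≤d → ℕₚ.≤-trans ≤d (ℕₚ.m≤n⊔m (size (proj₂ t)) _)) (size≤degN f)

ev-∑≤ : ∀ N (a : ℕ → Poly) (φ : ℕ → Comp → Poly) f →
        ∑≤ N (λ i → a i * ev (φ i) f) ≈ ev (λ w → ∑≤ N (λ i → a i * φ i w)) f
ev-∑≤ N a φ f = begin
  ∑≤ N (λ i → a i * ev (φ i) f)
    ≈⟨ ∑≤-cong N (λ i → ∑∈-distribˡ (a i) _ f) ⟩
  ∑≤ N (λ i → ∑∈ f (λ t → a i * (proj₁ t * φ i (proj₂ t))))
    ≈⟨ ∑≤-comm-∑∈ N (λ i t → a i * (proj₁ t * φ i (proj₂ t))) f ⟩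
  ∑∈ f (λ t → ∑≤ N (λ i → a i * (proj₁ t * φ i (proj₂ t))))
    ≈⟨ ∑∈-cong f (λ t → ≈-trans (∑≤-cong N (λ i → x∙yz≈y∙xz (a i) (proj₁ t) _))
                                (≈-sym (∑≤-distribˡ N (proj₁ t) _))) ⟩
  ev (λ w → ∑≤ N (λ i → a i * φ i w)) f ∎
  where
  open import Algebra.Properties.CommutativeSemigroup
    (CommutativeRing.*-commutativeSemigroup polyRing) using (x∙yz≈y∙xz)

-- The operators cut their series at `degN f`, which bounds the size of each word of `f`; identities
-- for sums truncated there may thus be used under `ev`.
ev-bounded-cong : ∀ {φ ψ f} → Pos f → (∀ {w} → Positive w → size w ≤ degN f → φ w ≈ ψ w) →
                  ev φ f ≈ ev ψ f
ev-bounded-cong {f = f} pf e =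
  ∑∈-cong-All (All.zipWith (λ {t} (pw , ≤d) → *-congˡ {proj₁ t} (e pw ≤d)) (pf , size≤degN f))

-- The transpose of left multiplication by H_{m+k}, where k is the degree removed so far.
prefixed : ℕ → (Comp → Poly) → ℕ → Comp → Poly
prefixed m φ k u = φ (consH (m ℕ.+ k) u)

-- In H_{m+i} F_{1ⁱ}^⊥ the shift i equals the degree removed, so the whole operator is one skewing
-- followed by a prefix that depends on this degree.
ev-BB : ∀ φ m {f} → Pos f → ev φ (BB m f) ≈ ev (skew (altE) (prefixed m φ) 0) f
ev-BB φ m {f} pf = begin
  ev φ (BB m f)
    ≈⟨ ≈-trans (ev-concat φ (map summand (upTo (suc N)))) (∑∈-map (ev φ) summand (upTo (suc N))) ⟩
  ∑∈ (upTo (suc N)) (ev φ ∘ summand)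
    ≈⟨ ∑∈-upTo _ N ⟩
  ∑≤ N (ev φ ∘ summand)
    ≈⟨ ∑≤-cong N (λ i → ≈-trans (ev-scaleN φ (signP i) (Hmul (m ℕ.+ i) (perpF1 i f)))
         (*-cong (≈-reflexive (signP≡sign i)) (≈-trans (ev-Hmul φ (m ℕ.+ i) (perpF1 i f))
           (≈-trans (ev-perpM (φ ∘ consH (m ℕ.+ i)) (replicate i 1) pf)
             (≈-reflexive (≡.cong (λ k → ev (λ w → ∑∈ (removals (replicate i 1) w) (prefixed m φ k)) f)
               (≡.sym (ℕₚ.+-identityʳ i)))))))) ⟩
  ∑≤ N (λ i → sign i * ev (λ w → ∑∈ (removals (replicate i 1) w) (prefixed m φ (i ℕ.+ 0))) f)
    ≈⟨ ev-∑≤ N sign _ f ⟩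
  ev (λ w → ∑≤ N (λ i → sign i * ∑∈ (removals (replicate i 1) w) (prefixed m φ (i ℕ.+ 0)))) f
    ≈⟨ ev-bounded-cong pf (λ pw w≤N → ∑-altE N (prefixed m φ) 0 pw w≤N) ⟩
  ev (skew (altE) (prefixed m φ) 0) f ∎
  where
  N = degN f
  summand = λ i → scaleN (signP i) (Hmul (m ℕ.+ i) (perpF1 i f))

-- The skewing by `qPow q` is outermost because F_i^⊥ reaches `f` before 𝔹_{m+i} does. The index m +
-- i is again m plus the removed degree, so `skew-shift` absorbs it.
ev-BBt : ∀ φ m {f} → Pos f →
         ev φ (BBt m f) ≈ ev (skew (qPow q) (skew (altE) (prefixed m φ)) 0) f
ev-BBt φ m {f} pf = begin
  ev φ (BBt m f)
    ≈⟨ ≈-trans (ev-concat φ (map summand (upTo (suc N)))) (∑∈-map (ev φ) summand (upTo (suc N))) ⟩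
  ∑∈ (upTo (suc N)) (ev φ ∘ summand)
    ≈⟨ ∑∈-upTo _ N ⟩
  ∑≤ N (ev φ ∘ summand)
    ≈⟨ ∑≤-cong N (λ i → ≈-trans (ev-scaleN φ (qpow i) (BB (m ℕ.+ i) (perpF i f)))
         (*-cong (qpow≈qPow i) (≈-trans (ev-BB φ (m ℕ.+ i) (perpF-Pos i f))
           (≈-trans (ev-cong (perpF i f) (shifted i)) (ev-perpF (Ψ (i ℕ.+ 0)) i pf))))) ⟩
  ∑≤ N (λ i → qPow q i * ev (λ w → F⊥ i w (Ψ (i ℕ.+ 0))) f)
    ≈⟨ ev-∑≤ N (qPow q) _ f ⟩
  ev (λ w → ∑≤ N (λ i → qPow q i * F⊥ i w (Ψ (i ℕ.+ 0)))) f
    ≈⟨ ev-bounded-cong pf (λ pw w≤N → ∑-qPow q N Ψ 0 pw w≤N) ⟩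
  ev (skew (qPow q) Ψ 0) f ∎
  where
  N = degN f
  summand = λ i → scaleN (qpow i) (BB (m ℕ.+ i) (perpF i f))
  Ψ = skew (altE) (prefixed m φ)
  shifted : ∀ i w → skew (altE) (prefixed (m ℕ.+ i) φ) 0 w ≈ Ψ (i ℕ.+ 0) w
  shifted i w = ≈-trans
    (skew-congʳ (altE) 0 w (λ k u → ≈-reflexive (≡.cong (λ n → φ (consH n u)) (ℕₚ.+-assoc m i k))))
    (skew-shift (altE) (prefixed m φ) i 0 w)

-- The expansion of H_β

power : ℕ → Poly
power = powP oneMinusQ

power-+ : ∀ i j → power (i ℕ.+ j) ≈ power i * power j
power-+ zero    j = ≈-sym (*-identityˡ (power j))
power-+ (suc i) j = ≈-trans (*-congˡ {oneMinusQ} (power-+ i j)) (≈-sym (*-assoc oneMinusQ (power i) (power j)))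

-- A smaller letter in any positive number of copies adds one distinct entry, that is one factor 1 -
-- q, and none if absent: exactly the coefficients of (1 - q x)/(1 - x).
power-replicate : ∀ s j {r} → All (s <_) r →
  power (distinctCount (replicate j s ++ r)) ≈ hook q j * power (distinctCount r)
power-replicate s zero    {r} s<r = ≈-sym (*-identityˡ (power (distinctCount r)))
power-replicate s (suc j)     s<r =
  -- Here `1# - q` computes to the list `oneMinusQ`.
  ≈-reflexive (≡.cong (power ∘ length) (deduplicate-replicate s j s<r))

-- The number of copies of a letter placed in the row is the amount by which its part is lowered,
-- and the length of this piece of row is the removed degree. The exponent carries no -1, as the
-- leading letter of the full row lies outside the piece.
∑-splits : ∀ {n} s (c : Vec ℕ n) (Φ : ℕ → Comp → Poly) m →
  ∑∈ (splits s c) (λ rd → power (distinctCount (proj₁ rd)) *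
                          Φ (length (proj₁ rd) ℕ.+ m) (strip (toList (proj₂ rd)))) ≈
  skew (hook q) Φ m (toList c)
∑-splits s []      Φ m = ≈-trans (+-identityʳ _) (*-identityˡ (Φ m []))
∑-splits s (x ∷ c) Φ m = begin
  ∑∈ (splits s (x ∷ c)) weight
    ≈⟨ ∑∈-concatMap weight (λ j → map (distribute s x j) (splits (suc s) c)) (upTo (suc x)) ⟩
  ∑∈ (upTo (suc x)) (λ j → ∑∈ (map (distribute s x j) (splits (suc s) c)) weight)
    ≈⟨ ∑∈-upTo _ x ⟩
  ∑≤ x (λ j → ∑∈ (map (distribute s x j) (splits (suc s) c)) weight)
    ≈⟨ ∑≤-cong x (λ j → ≈-trans (∑∈-map weight (distribute s x j) (splits (suc s) c))
         (≈-trans (∑∈-cong-All (All.tabulate (λ {rd} rd∈ → factor j rd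
                    (InRange⇒> (Split.row-range (splits-sound (suc s) c rd∈))))))
           (≈-trans (≈-sym (∑∈-distribˡ (hook q j) _ (splits (suc s) c)))
             (*-congˡ {hook q j}
               (∑-splits (suc s) c (λ k u → Φ k (consH (x ∸ j) u)) (j ℕ.+ m)))))) ⟩
  skew (hook q) Φ m (toList (x ∷ c)) ∎
  where
  weight : List ℕ × Vec ℕ _ → Poly
  weight rd = power (distinctCount (proj₁ rd)) * Φ (length (proj₁ rd) ℕ.+ m) (strip (toList (proj₂ rd)))
  len : ∀ j r → length (replicate j s ++ r) ℕ.+ m ≡ length r ℕ.+ (j ℕ.+ m)
  len j r = ≡.trans (≡.cong (ℕ._+ m) (≡.trans (length-++ (replicate j s))
      (≡.trans (≡.cong (ℕ._+ length r) (length-replicate j)) (ℕₚ.+-comm j (length r)))))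
    (ℕₚ.+-assoc (length r) j m)
  factor : ∀ j rd → All (s <_) (proj₁ rd) → weight (distribute s x j rd) ≈
    hook q j * (power (distinctCount (proj₁ rd)) *
      Φ (length (proj₁ rd) ℕ.+ (j ℕ.+ m)) (consH (x ∸ j) (strip (toList (proj₂ rd)))))
  factor j (r , d) s<r = ≈-trans
    (*-cong (power-replicate s j s<r)
      (≈-reflexive (≡.cong (λ k → Φ k (consH (x ∸ j) (strip (toList d)))) (len j r))))
    (*-assoc (hook q j) (power (distinctCount r)) _)

term : (Comp → Poly) → Tableau → Poly
term φ T = power (nStat T) * ev φ (Q' (shape T))

-- The -1 in `nStat` is spent on the leading letter s. The row has length `suc b` plus that of `r`,
-- so its operator is the term k = `length r` of H_m f = Σ_k 𝔹̃_{m+k} (G_k^⊥ f) for m = `suc b`.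
term-∷ : ∀ φ s b {r} T → All (s <_) r →
  term φ ((replicate (suc b) s ++ r) ∷ T) ≈
  power (distinctCount r) * term (skew (qPow q) (skew (altE) (prefixed (suc b) φ)) (length r ℕ.+ 0)) T
term-∷ φ s b {r} T s<r = begin
  power (distinctCount (replicate (suc b) s ++ r) ∸ 1 ℕ.+ nStat T) *
    ev φ (BBt (length (replicate (suc b) s ++ r)) (Q' (shape T)))
    ≈⟨ *-cong (≈-trans (≈-reflexive (≡.cong (λ w → power (length w ∸ 1 ℕ.+ nStat T))
                          (deduplicate-replicate s b s<r)))
                       (power-+ (distinctCount r) (nStat T)))
              (≈-trans (≈-reflexive (≡.cong (λ k → ev φ (BBt k (Q' (shape T))))
                          (≡.trans (length-++ (replicate (suc b) s))
                                   (≡.cong (ℕ._+ ℓ) (length-replicate (suc b))))))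
                (≈-trans (ev-BBt φ (suc b ℕ.+ ℓ) (Q'-Pos (shape T)))
                         (ev-cong (Q' (shape T)) shifted))) ⟩
  power (distinctCount r) * power (nStat T) * ev (skew (qPow q) Ψ (ℓ ℕ.+ 0)) (Q' (shape T))
    ≈⟨ *-assoc (power (distinctCount r)) (power (nStat T)) _ ⟩
  power (distinctCount r) * term (skew (qPow q) Ψ (ℓ ℕ.+ 0)) T ∎
  where
  ℓ = length r
  Ψ = skew (altE) (prefixed (suc b) φ)
  shifted : ∀ w → skew (qPow q) (skew (altE) (prefixed (suc b ℕ.+ ℓ) φ)) 0 w ≈ skew (qPow q) Ψ (ℓ ℕ.+ 0) w
  shifted w = ≈-trans (skew-congʳ (qPow q) 0 w (λ k u → ≈-trans
    (skew-congʳ (altE) k u (λ i v → ≈-reflexive (≡.cong (λ n → φ (consH n v)) (ℕₚ.+-assoc (suc b) ℓ i))))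
    (skew-shift (altE) (prefixed (suc b) φ) ℓ k u)))
    (skew-shift (qPow q) Ψ ℓ 0 w)

-- For a fixed first row, the induction hypothesis sums the lower rows with the functional `Θ` that
-- this row produces. Summing over first rows is then skewing by G, and `Θ` contains precisely its
-- inverse.
∑-tableaux : ∀ {n} s (c : Vec ℕ n) φ → ∑∈ (tableaux s c) (term φ) ≈ φ (strip (toList c))
∑-tableaux s [] φ = begin
  1# * (1# * φ [] + 0#) + 0#
    ≈⟨ ≈-trans (+-identityʳ _) (≈-trans (*-identityˡ _) (≈-trans (+-identityʳ _) (*-identityˡ (φ [])))) ⟩
  φ [] ∎
-- A letter without copies opens no row, and `strip` deletes its part.
∑-tableaux s (zero ∷ c)  φ = ∑-tableaux (suc s) c φ
∑-tableaux s (suc b ∷ c) φ = begin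
  ∑∈ (tableaux s (suc b ∷ c)) (term φ)
    ≈⟨ ∑∈-concatMap (term φ) (λ rd → map (row rd ∷_) (tableaux (suc s) (proj₂ rd))) (splits (suc s) c) ⟩
  ∑∈ (splits (suc s) c) (λ rd → ∑∈ (map (row rd ∷_) (tableaux (suc s) (proj₂ rd))) (term φ))
    ≈⟨ ∑∈-cong-All (All.tabulate (λ {rd} rd∈ → rest rd
         (InRange⇒> (Split.row-range (splits-sound (suc s) c rd∈))))) ⟩
  ∑∈ (splits (suc s) c) (λ rd → power (distinctCount (proj₁ rd)) *
                                Θ (length (proj₁ rd) ℕ.+ 0) (strip (toList (proj₂ rd))))
    ≈⟨ ∑-splits (suc s) c Θ 0 ⟩
  skew (hook q) Θ 0 (toList c)
    ≈⟨ skew-inverse q (prefixed (suc b) φ) 0 (toList c) ⟩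
  φ (suc b ℕ.+ 0 ∷ strip (toList c))
    ≈⟨ ≈-reflexive (≡.cong (λ k → φ (k ∷ strip (toList c))) (ℕₚ.+-identityʳ (suc b))) ⟩
  φ (suc b ∷ strip (toList c)) ∎
  where
  row : List ℕ × Vec ℕ _ → List ℕ
  row rd = replicate (suc b) s ++ proj₁ rd
  Θ : ℕ → Comp → Poly
  Θ = skew (qPow q) (skew (altE) (prefixed (suc b) φ))
  rest : ∀ rd → All (s <_) (proj₁ rd) →
    ∑∈ (map (row rd ∷_) (tableaux (suc s) (proj₂ rd))) (term φ) ≈
    power (distinctCount (proj₁ rd)) * Θ (length (proj₁ rd) ℕ.+ 0) (strip (toList (proj₂ rd)))
  rest (r , d) s<r = begin
    ∑∈ (map (row (r , d) ∷_) (tableaux (suc s) d)) (term φ)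
      ≈⟨ ∑∈-map (term φ) (row (r , d) ∷_) (tableaux (suc s) d) ⟩
    ∑∈ (tableaux (suc s) d) (λ T → term φ (row (r , d) ∷ T))
      ≈⟨ ∑∈-cong (tableaux (suc s) d) (λ T → term-∷ φ s b T s<r) ⟩
    ∑∈ (tableaux (suc s) d) (λ T → power (distinctCount r) * term (Θ (length r ℕ.+ 0)) T)
      ≈⟨ ∑∈-distribˡ (power (distinctCount r)) _ (tableaux (suc s) d) ⟨
    power (distinctCount r) * ∑∈ (tableaux (suc s) d) (term (Θ (length r ℕ.+ 0)))
      ≈⟨ *-congˡ {power (distinctCount r)} (∑-tableaux (suc s) d (Θ (length r ℕ.+ 0))) ⟩
    power (distinctCount r) * Θ (length r ℕ.+ 0) (strip (toList d)) ∎

strip-positive : ∀ {w} → Positive w → strip w ≡ w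
strip-positive []                      = ≡.refl
strip-positive {suc x ∷ w} (px ∷ pw)   = ≡.cong (suc x ∷_) (strip-positive pw)

ev-rhs : ∀ φ {β} → Positive β → ev φ (rhs β) ≈ φ β
ev-rhs φ {β} pβ = begin
  ev φ (rhs β)
    ≈⟨ ≈-trans (ev-concat φ (map summand (immaculateTableaux β)))
         (∑∈-map (ev φ) summand (immaculateTableaux β)) ⟩
  ∑∈ (immaculateTableaux β) (λ T → ev φ (summand T))
    ≈⟨ ∑∈-cong (immaculateTableaux β) (λ T → ev-scaleN φ (power (nStat T)) (Q' (shape T))) ⟩
  ∑∈ (immaculateTableaux β) (term φ)
    ≈⟨ ∑∈-↭ (term φ) (immaculateTableaux-↭ β) ⟩
  ∑∈ (tableaux 1 (fromList β)) (term φ)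
    ≈⟨ ∑-tableaux 1 (fromList β) φ ⟩
  φ (strip (toList (fromList β)))
    ≈⟨ ≈-reflexive (≡.cong φ (≡.trans (≡.cong strip (Vecₚ.toList∘fromList β)) (strip-positive pβ))) ⟩
  φ β ∎
  where
  summand : Tableau → NSym
  summand T = scaleN (power (nStat T)) (Q' (shape T))

-- The functional that extracts the coefficient of H_α; it turns the identity for all functionals
-- into equality of coefficients.
indicator : Comp → Comp → Poly
indicator α w = if w == α then 1# else 0#

coeffN≈ev : ∀ f α → coeffN f α ≈ ev (indicator α) f
coeffN≈ev []            α = ≈-refl
coeffN≈ev ((c , w) ∷ f) α with w == α
... | true  = +-cong (≈-sym (*-identityʳ c)) (coeffN≈ev f α)
... | false = ≈-trans (coeffN≈ev f α) (≈-sym (≈-trans (+-congʳ (zeroʳ c)) (+-identityˡ _)))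

theorem4p10 : (β : Comp) → IsComposition β → H β ≈N rhs β
theorem4p10 β pβ α = _≋_.coefs (begin
  coeffN (H β) α              ≈⟨ coeffN≈ev (H β) α ⟩
  1# * indicator α β + 0#     ≈⟨ ≈-trans (+-identityʳ _) (*-identityˡ (indicator α β)) ⟩
  indicator α β               ≈⟨ ev-rhs (indicator α) pβ ⟨
  ev (indicator α) (rhs β)    ≈⟨ coeffN≈ev (rhs β) α ⟨
  coeffN (rhs β) α            ∎)
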